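{- Let $\mathcal G=(N,Z,P)$ be a hyperedge replacement grammar (HRG) over the color set $\mathrm{COL}$ such that every hypergraph in $\mathcal L(\mathcal G)$ is a labeled transition system, let $\mathcal M$ be a Büchi automaton over the alphabet $2^{\mathrm{COL}}$, and let $\mathcal G_{\mathcal M}$ be the $\mathcal M$-recoloring of $\mathcal G$, an HRG over the color set $\mathrm{COL}\uplus\{\mathcal M\}$. Then $$\forall \mathcal H\in\mathcal L(\mathcal G_{\mathcal M})\ \forall v\in V_{\mathcal H}.\quad \mathcal M\in\gamma_{\mathcal H}(v)\iff (\mathcal H,v)\models\mathcal M .$$
   Context: **Hypergraphs.** Fix sets $\mathrm{COL}$ (node colors), $\mathrm{ACT}$ (actions), $\mathrm{LAB}$ (hyperedge labels). A hypergraph (HG) is $\mathcal H=(V,n,\to,E,\alpha,\gamma,\ell)$ with a finite set $V$ of concrete nodes, abstract nodes $I=\{1,\dots,n\}$, all nodes $W=V\uplus I$, edges $\to\subseteq W\times\mathrm{ACT}\times W$, a finite set $E$ of hyperedges, attached-node sequences $\alpha:E\to W^*$, colors $\gamma:V\to 2^{\mathrm{COL}}$, and labels $\ell:E\to\mathrm{LAB}$. Components of $\mathcal H$ carry index $\mathcal H$. HGs are considered up to isomorphism. An HG with no abstract nodes and no hyperedges is a labeled transition system. **Replacement.** An assignment $\mathcal K$ on $\mathcal H$ maps each $e\in E_{\mathcal H}$ to an HG $\mathcal K(e)$ with $n_{\mathcal K(e)}=|\alpha_{\mathcal H}(e)|$. Then $\mathcal H[\mathcal K]$ has $n=n_{\mathcal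 H}$, concrete nodes $V_{\mathcal H}\uplus\biguplus_e V_{\mathcal K(e)}$, hyperedges $\biguplus_e E_{\mathcal K(e)}$, and the inherited colors and labels. With $f_e(i)=\alpha_{\mathcal H}(e)_i$ for abstract $i$ and $f_e(v)=v$ for concrete $v$ of $\mathcal K(e)$, its edges are those of $\mathcal H$ together with all $(f_e(u),a,f_e(v))$ for $u\xrightarrow{a}_{\mathcal K(e)}v$, and a hyperedge $e'$ of $\mathcal K(e)$ is attached to $f_e(\alpha_{\mathcal K(e)}(e'))$. If $\mathcal H$ has exactly one hyperedge, $\mathcal H[\mathcal K]$ also denotes replacing it by the HG $\mathcal K$. The handle $A^\circ$ of a label $A$ of arity $k$ has no concrete nodes, no edges, $k$ abstract nodes, and one hyperedge labeled $A$ attached to $1\,2\cdots k$. **HRGs.** An HRG is $\mathcal G=(N,Z,P)$ with a finite set $N$ of nonterminals with arities $\mathrm{ar}:N\to\mathbb N$, start symbols $Z\subseteq N$, and a finite set $P$ of rules $(A,\mathcal R)$, where $A\in N$, $\mathcal R$ is an HG with $n_{\mathcal R}=\mathrm{ar}(A)$, and each $e\in E_{\mathcal R}$ has $\ell_{\mathcal R}(e)\in N$ and $|\alpha_{\mathcal R}(e)|=\mathrm{ar}(\ell_{\mathcal R}(e))$. Derivation trees of $A$: (1) $A$ itself; (2) $(\mathcal R,T)$ for $(A,\mathcal R)\in P$ and $T$ assigning to each $e\in E_{\mathcal R}$ a derivation tree of $\ell_{\mathcal R}(e)$. A tree is complete if (1) is never used, and has hole $B$ if (1) is used exactly once, with $B$.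 The assembled HG is $(\!|A|\!)=A^\circ$, $(\!|(\mathcal R,T)|\!)=\mathcal R[\lambda e.(\!|T(e)|\!)]$. $\mathcal L_A(\mathcal G)$ is the set of HGs assembled from complete trees of $A$; $\mathcal L(\mathcal G)=\bigcup_{A\in Z}\mathcal L_A(\mathcal G)$. The set of contexts $\mathcal C_B(\mathcal G)$ consists of the HGs assembled from derivation trees of some $A\in Z$ with hole $B$. **Büchi automata.** $\mathcal M=(Q,\Sigma,\Delta,Q_0,F)$ with $\Sigma=2^{\mathrm{COL}}$, $Q$ finite, $\Delta\subseteq Q\times\Sigma\times Q$, $Q_0,F\subseteq Q$. For a finite word $\sigma$, $(p,\sigma,q,b)\in\Delta^*$ iff there is a run on $\sigma$ from $p$ to $q$ and the Boolean $b$ is true exactly when this run visits a state in $F$ (endpoints included). For an infinite word $\sigma$, $(p,\sigma,\mathtt T)\in\Delta^\omega$ iff there is a run on $\sigma$ from $p$ visiting some state of $F$ infinitely often. $\mathcal L(\mathcal M)=\{\sigma\in\Sigma^\omega\mid\exists q_0\in Q_0.\,(q_0,\sigma,\mathtt T)\in\Delta^\omega\}$. Finite words $\sigma,\sigma'$ are $\mathcal M$-equivalent if $(p,\sigma,q,b)\in\Delta^*\iff(p,\sigma',q,b)\in\Delta^*$ for all $p,q,b$; infinite words are $\mathcal M$-equivalent if $(p,\sigma,\mathtt T)\in\Delta^\omega\iff(p,\sigma',\mathtt T)\in\Delta^\omega$ for all $p$. Two sets of words are $\mathcal M$-equivalent if every word in either one has an $\mathcal M$-equivalent word in the other. **Traces.**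 A path is a finite or infinite sequence of nodes with consecutive nodes joined by an edge (any action). $\mathrm{Traces}^*_{\mathcal H}(u,v)$ is the set of color words $\gamma_{\mathcal H}((u\,\bar p\,v)|_{V_{\mathcal H}})$ (abstract nodes deleted, then colors taken) for paths $u\,\bar p\,v$ with $\bar p\in V_{\mathcal H}^*$; both endpoints are listed, so such a path has at least one edge, also when $u=v$. $\mathrm{Traces}^\omega_{\mathcal H}(u)$ is the set of $\gamma_{\mathcal H}((u\,\bar p)|_{V_{\mathcal H}})$ for infinite paths $u\,\bar p$ with $\bar p\in V_{\mathcal H}^\omega$. $(\mathcal H,v)\models\mathcal M$ iff $\mathrm{Traces}^\omega_{\mathcal H}(v)\subseteq\mathcal L(\mathcal M)$. If nodes of $\mathcal H$ may carry the extra color $\mathcal M$, it is deleted from all nodes before evaluating $(\mathcal H,v)\models\mathcal M$. **$\mathcal M$-equivalence with empty view.** Let $X_{\mathcal H}$ be the set of abstract nodes and of nodes attached to some hyperedge of $\mathcal H$. $(\mathcal H,\emptyset)\equiv_{\mathcal M}(\mathcal H',\emptyset)$ iff $n_{\mathcal H}=n_{\mathcal H'}$ and there are bijections $\mu:E_{\mathcal H}\to E_{\mathcal H'}$ and $\nu:X_{\mathcal H}\to X_{\mathcal H'}$ with $\nu(i)=i$ for abstract $i$ and $\nu(\alpha_{\mathcal H}(e)_i)=\alpha_{\mathcal H'}(\mu(e))_i$ (sequences of equal length) such that for all $x,y\in X_{\mathcal H}$ the sets $\mathrm{Traces}^*_{\mathcal H}(x,y)$ and $\mathrm{Traces}^*_{\mathcal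 H'}(\nu x,\nu y)$ are $\mathcal M$-equivalent, and so are $\mathrm{Traces}^\omega_{\mathcal H}(x)$ and $\mathrm{Traces}^\omega_{\mathcal H'}(\nu x)$. Hyperedge labels play no role. $[\![\mathcal H]\!]$ denotes the class of $(\mathcal H,\emptyset)$. Replacement and $\models$ are lifted to classes through representatives. **Refined HRG** $\mathcal G_{\equiv}=(N_\equiv,Z_\equiv,P_\equiv)$ for $\equiv\,=\,\equiv_{\mathcal M}$. $N_\equiv$ is the set of $(A,\mathfrak s,\mathfrak c)$ with $A\in N$, $\mathfrak s=[\![\mathcal H]\!]$ for some $\mathcal H\in\mathcal L_A(\mathcal G)$, $\mathfrak c=[\![\mathcal J]\!]$ for some $\mathcal J\in\mathcal C_A(\mathcal G)$, of arity $\mathrm{ar}(A)$. $Z_\equiv=\{(A,\mathfrak s,[\![A^\circ]\!])\in N_\equiv\mid A\in Z\}$. $P_\equiv$ contains, for every rule $(A,\mathcal R)\in P$ with labels $B(e)=\ell_{\mathcal R}(e)$, each rule with left side $(A,\mathfrak s,\mathfrak c)\in N_\equiv$ and right side $\mathcal R$ with each hyperedge $e$ relabeled to $(B(e),\mathfrak t(e),\mathfrak d(e))\in N_\equiv$, where $\mathfrak s=\mathcal R[\mathfrak t]$ and, for each $e$, $\mathfrak d(e)=\mathfrak c[\mathcal R[\mathfrak t\langle e/B(e)^\circ\rangle]]$; here $\mathfrak t\langle e/B(e)^\circ\rangle$ assigns the handle $B(e)^\circ$ to $e$ and agrees with $\mathfrak t$ on the other hyperedges. **Recolored HRG** $\mathcal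 G_{\mathcal M}$. It has nonterminals $N_\equiv$ and start symbols $Z_\equiv$. Its rules are obtained from the rules of $P_\equiv$ (with left side $(A,\mathfrak s,\mathfrak c)$, underlying HG $\mathcal R$, and hyperedge labels $(B(e),\mathfrak t(e),\mathfrak d(e))$) by replacing $\mathcal R$ by the HG $\mathcal R'$ that is identical except that each concrete node $v\in V_{\mathcal R}$ additionally gets the color $\mathcal M$ iff $(\mathfrak c[\mathcal R[\mathfrak t]],v)\models\mathcal M$ with all nodes of $V_{\mathcal R}$ exposed, i.e. iff $(\mathcal J[\mathcal R[\mathcal K]],v)\models\mathcal M$ for representatives $\mathcal J$ of $\mathfrak c$ and $\mathcal K(e)$ of $\mathfrak t(e)$, $e\in E_{\mathcal R}$.
   Formalization: M-equivalence with empty view additionally requires matched nodes x and ν(x) to have M-equivalent color words (one letter if concrete, empty if abstract); without this it is not compatible with replacement, the recoloring is ill-defined on classes and the claim fails. -}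

module Defs where

open import Axiom.ExcludedMiddle public using (ExcludedMiddle)
open import Data.Bool.Base public using (Bool; true; false)
open import Data.Empty using (⊥)
open import Data.Fin.Base using (Fin; zero; suc; cast)
open import Data.Fin.Properties using (inj⇒≟; +↔⊎)
open import Data.List.Base using (List; []; _∷_; _++_; map)
open import Data.Nat.Base using (ℕ; zero; suc; _+_; _≤_)
open import Data.Product.Base public using (Σ; ∃; Σ-syntax; ∃-syntax; _×_; _,_; proj₁; proj₂)
open import Data.Product.Function.Dependent.Propositional using (Σ-↔)
open import Data.Sum.Base public using (_⊎_; inj₁; inj₂; [_,_])
import Data.Sum.Base as Sum
open import Data.Sum.Function.Propositional using (_⊎-↔_)
open import Data.Unit.Base public using (⊤; tt)
open import Data.Vec.Functional using (Vector)
open import Function.Base using (_∘_; const)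
open import Function.Bundles public using (_↔_; _⇔_; Inverse; mk↔ₛ′)
open import Function.Properties.Inverse using (↔-refl; ↔-sym; ↔-trans; ↔⇒↣)
open import Level public using (Level; 0ℓ; _⊔_) renaming (suc to lsuc)
open import Relation.Binary.Bundles using (Setoid)
open import Relation.Binary.Definitions using (DecidableEquality)
import Relation.Binary.Construct.On as On
open import Relation.Binary.PropositionalEquality public
  using (_≡_; _≢_; _≗_; refl; sym; trans; cong; subst; setoid)
open import Relation.Nullary public using (¬_; yes; no)
open import Relation.Unary public using (Pred; _∈_; _⊆′_)

private variable
  a b : Level
  k n n′ : ℕ

------------------------------------------------------------------------
-- Finite sets

Finite : Set → Set
Finite A = ∃[ k ] (A ↔ Fin k)

finite-≟ : {A : Set} → Finite A → DecidableEquality A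
finite-≟ (_ , A↔k) = inj⇒≟ (↔⇒↣ A↔k)

finite-⊥ : Finite ⊥
finite-⊥ = 0 , mk↔ₛ′ (λ ()) (λ ()) (λ ()) (λ ())

finite-⊤ : Finite ⊤
finite-⊤ = 1 , mk↔ₛ′ (λ _ → zero) (λ _ → tt) (λ { zero → refl }) (λ _ → refl)

finite-⊎ : {A B : Set} → Finite A → Finite B → Finite (A ⊎ B)
finite-⊎ (m , f) (n , g) = m + n , ↔-trans (f ⊎-↔ g) (↔-sym +↔⊎)

private
  Σ-Fin-suc : {B : Fin (suc k) → Set} →
              Σ (Fin (suc k)) B ↔ (B zero ⊎ Σ (Fin k) (B ∘ suc))
  Σ-Fin-suc = mk↔ₛ′
    (λ { (zero , y) → inj₁ y ; (suc i , y) → inj₂ (i , y) })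
    (λ { (inj₁ y) → zero , y ; (inj₂ (i , y)) → suc i , y })
    (λ { (inj₁ _) → refl ; (inj₂ _) → refl })
    (λ { (zero , _) → refl ; (suc _ , _) → refl })

  finite-ΣFin : ∀ k {B : Fin k → Set} → (∀ i → Finite (B i)) → Finite (Σ (Fin k) B)
  finite-ΣFin zero    _  = 0 , mk↔ₛ′ (λ { (() , _) }) (λ ()) (λ ()) (λ { (() , _) })
  finite-ΣFin (suc k) fB =
    let (m , f) = finite-⊎ (fB zero) (finite-ΣFin k (fB ∘ suc))
    in  m , ↔-trans Σ-Fin-suc f

finite-Σ : {A : Set} {B : A → Set} → Finite A → (∀ x → Finite (B x)) → Finite (Σ A B)
finite-Σ {B = B} (k , A↔k) fB =
  let (m , f) = finite-ΣFin k (λ i → fB (Inverse.from A↔k i))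
  in  m , ↔-trans (↔-sym (Σ-↔ {B = B} (↔-sym A↔k) (↔-refl))) f

------------------------------------------------------------------------
-- Hypergraphs

Letter : Set → Set
Letter COL = COL → Bool

-- The number n of abstract nodes is an index.
record HG (ACT COL : Set) (LAB : Set a) (n : ℕ) : Set (lsuc 0ℓ ⊔ a) where
  field
    V        : Set
    V-finite : Finite V
    E        : Set
    E-finite : Finite E

  W : Set
  W = V ⊎ Fin n

  field
    _⟶⟨_⟩_ : W → ACT → W → Set
    len    : E → ℕ
    α      : (e : E) → Vector W (len e)
    γ      : V → Letter COL
    ℓ      : E → LAB

  _⟶_ : W → W → Set
  u ⟶ v = ∃[ x ] u ⟶⟨ x ⟩ v

  _≟E_ : DecidableEquality E
  _≟E_ = finite-≟ E-finite

  concrete : W → List V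
  concrete = [ (λ v → v ∷ []) , (λ _ → []) ]

open HG

IsLTS : {ACT COL : Set} {LAB : Set a} → HG ACT COL LAB n → Set
IsLTS {n = n} H = n ≡ 0 × ¬ E H

record _≅_ {ACT COL : Set} {LAB : Set a}
           (H : HG ACT COL LAB n) (H′ : HG ACT COL LAB n′) : Set a where
  field
    n≡  : n ≡ n′
    V↔  : V H ↔ V H′
    E↔  : E H ↔ E H′

  onV : V H → V H′
  onV = Inverse.to V↔

  onE : E H → E H′
  onE = Inverse.to E↔

  onW : W H → W H′
  onW = Sum.map onV (cast n≡)

  field
    edges : ∀ u x v → (_⟶⟨_⟩_ H u x v) ⇔ (_⟶⟨_⟩_ H′ (onW u) x (onW v))
    len≡  : ∀ e → len H e ≡ len H′ (onE e)
    α≡    : ∀ e i → onW (α H e i) ≡ α H′ (onE e) (cast (len≡ e) i)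
    γ≗    : ∀ v → γ H v ≗ γ H′ (onV v)
    ℓ≡    : ∀ e → ℓ H e ≡ ℓ H′ (onE e)

------------------------------------------------------------------------
-- Replacement

module _ {ACT COL : Set} {LAB : Set a} {LAB′ : Set b} (H : HG ACT COL LAB n)
         {k : E H → ℕ} (K : (e : E H) → HG ACT COL LAB′ (k e))
         (k≡ : ∀ e → k e ≡ len H e) where

  private
    V[] : Set
    V[] = V H ⊎ Σ[ e ∈ E H ] V (K e)

    W[] : Set
    W[] = V[] ⊎ Fin n

  outerNode : W H → W[]
  outerNode = Sum.map₁ inj₁

  innerNode : (e : E H) → W (K e) → W[]
  innerNode e (inj₁ v) = inj₁ (inj₂ (e , v))
  innerNode e (inj₂ i) = outerNode (α H e (cast (k≡ e) i))

  data ReplaceEdge : W[] → ACT → W[] → Set where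
    outer : ∀ {u x v} → _⟶⟨_⟩_ H u x v →
            ReplaceEdge (outerNode u) x (outerNode v)
    inner : ∀ e {u x v} → _⟶⟨_⟩_ (K e) u x v →
            ReplaceEdge (innerNode e u) x (innerNode e v)

  replace : HG ACT COL LAB′ n
  replace = record
    { V        = V[]
    ; V-finite = finite-⊎ (V-finite H) (finite-Σ (E-finite H) (λ e → V-finite (K e)))
    ; E        = Σ[ e ∈ E H ] E (K e)
    ; E-finite = finite-Σ (E-finite H) (λ e → E-finite (K e))
    ; _⟶⟨_⟩_   = ReplaceEdge
    ; len      = λ (e , e′) → len (K e) e′
    ; α        = λ (e , e′) i → innerNode e (α (K e) e′ i)
    ; γ        = [ γ H , (λ (e , v) → γ (K e) v) ]
    ; ℓ        = λ (e , e′) → ℓ (K e) e′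
    }

handle : {ACT COL : Set} {LAB : Set a} → LAB → (k : ℕ) → HG ACT COL LAB k
handle A k = record
  { V        = ⊥
  ; V-finite = finite-⊥
  ; E        = ⊤
  ; E-finite = finite-⊤
  ; _⟶⟨_⟩_   = λ _ _ _ → ⊥
  ; len      = λ _ → k
  ; α        = λ _ → inj₂
  ; γ        = λ ()
  ; ℓ        = λ _ → A
  }

-- Exactly one hyperedge, attached to k nodes.
record OneHole {ACT COL : Set} {LAB : Set a} (H : HG ACT COL LAB n) (k : ℕ) : Set where
  field
    hole   : E H
    unique : ∀ e → e ≡ hole
    k≡len  : ∀ e → k ≡ len H e

plug : {ACT COL : Set} {LAB : Set a} {LAB′ : Set b} (H : HG ACT COL LAB n) →
       OneHole H k → HG ACT COL LAB′ k → HG ACT COL LAB′ n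
plug H h X = replace H (λ _ → X) (OneHole.k≡len h)

relabel : {ACT COL : Set} {LAB : Set a} {LAB′ : Set b} (H : HG ACT COL LAB n) →
          (E H → LAB′) → HG ACT COL LAB′ n
relabel H l = record
  { V = V H ; V-finite = V-finite H ; E = E H ; E-finite = E-finite H
  ; _⟶⟨_⟩_ = _⟶⟨_⟩_ H ; len = len H ; α = α H ; γ = γ H ; ℓ = l }

recolour : {ACT COL COL′ : Set} {LAB : Set a} (H : HG ACT COL LAB n) →
           (V H → Letter COL′) → HG ACT COL′ LAB n
recolour H g = record
  { V = V H ; V-finite = V-finite H ; E = E H ; E-finite = E-finite H
  ; _⟶⟨_⟩_ = _⟶⟨_⟩_ H ; len = len H ; α = α H ; γ = g ; ℓ = ℓ H }

------------------------------------------------------------------------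
-- Hyperedge replacement grammars

-- The rules with left side A are indexed by P A.  Finiteness is kept separate
-- (see HRG) because equality of the refined nonterminals is an equivalence
-- relation other than _≡_.
record Grammar (ACT COL : Set) (a : Level) : Set (lsuc (lsuc 0ℓ ⊔ a)) where
  field
    N    : Set a
    ar   : N → ℕ
    Z    : Pred N 0ℓ
    P    : N → Set a
    rhs  : ∀ {A} → P A → HG ACT COL N (ar A)
    rank : ∀ {A} (r : P A) e → len (rhs r) e ≡ ar (ℓ (rhs r) e)

record HRG (ACT COL : Set) : Set₂ where
  field
    grammar : Grammar ACT COL 0ℓ
  open Grammar grammar public
  field
    N-finite : Finite N
    P-finite : ∀ A → Finite (P A)

module Derivation {ACT COL : Set} (G : Grammar ACT COL a) where
  open Grammar G

  data Tree : N → Set a where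
    leaf : ∀ A → Tree A
    node : ∀ {A} (r : P A) → ((e : E (rhs r)) → Tree (ℓ (rhs r) e)) → Tree A

  data Complete : ∀ {A} → Tree A → Set a where
    node : ∀ {A} {r : P A} {T} → (∀ e → Complete (T e)) → Complete (node r T)

  -- HasHole B T: exactly one leaf of T has the form (leaf C), and C is B.
  data HasHole (B : N) : ∀ {A} → Tree A → Set a where
    leaf : HasHole B (leaf B)
    node : ∀ {A} {r : P A} {T} (e : E (rhs r)) → HasHole B (T e) →
           (∀ e′ → e′ ≢ e → Complete (T e′)) → HasHole B (node r T)

  assemble : ∀ {A} → Tree A → HG ACT COL N (ar A)
  assemble (leaf A)   = handle A (ar A)
  assemble (node r T) = replace (rhs r) (λ e → assemble (T e)) (λ e → sym (rank r e))

  -- Hypergraphs are taken up to isomorphism.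
  𝓛[_] : N → Pred (HG ACT COL N n) a
  𝓛[ A ] H = Σ[ T ∈ Tree A ] Complete T × H ≅ assemble T

  𝓛 : Pred (HG ACT COL N n) a
  𝓛 H = ∃[ A ] A ∈ Z × H ∈ 𝓛[ A ]

  𝓒[_] : N → Pred (HG ACT COL N n) a
  𝓒[ B ] J = ∃[ A ] A ∈ Z × (Σ[ T ∈ Tree A ] HasHole B T × J ≅ assemble T)

------------------------------------------------------------------------
-- Büchi automata over the alphabet 2^COL

record Büchi (COL : Set) : Set₁ where
  field
    Q        : Set
    Q-finite : Finite Q
    Δ        : Q → Letter COL → Q → Set
    -- Letters are sets of colours, hence compared extensionally.
    Δ-resp   : ∀ {p x y q} → x ≗ y → Δ p x q → Δ p y q
    Q₀       : Pred Q 0ℓ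
    F        : Pred Q 0ℓ

  data Run : Q → List (Letter COL) → Q → Set where
    []  : ∀ {p} → Run p [] p
    _∷_ : ∀ {p q r x σ} → Δ p x q → Run q σ r → Run p (x ∷ σ) r

  data Visits : ∀ {p σ q} → Run p σ q → Set where
    last  : ∀ {p} → p ∈ F → Visits ([] {p})
    here  : ∀ {p q r x σ} {δ : Δ p x q} {ρ : Run q σ r} → p ∈ F → Visits (δ ∷ ρ)
    there : ∀ {p q r x σ} {δ : Δ p x q} {ρ : Run q σ r} → Visits ρ → Visits (δ ∷ ρ)

  Δ* : Q → List (Letter COL) → Q → Bool → Set
  Δ* p σ q b = Σ[ ρ ∈ Run p σ q ] (b ≡ true ⇔ Visits ρ)

  Δω : Q → (ℕ → Letter COL) → Set
  Δω p σ = Σ[ ρ ∈ (ℕ → Q) ] ρ 0 ≡ p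
         × (∀ i → Δ (ρ i) (σ i) (ρ (suc i)))
         × (∃[ f ] f ∈ F × (∀ i → ∃[ j ] i ≤ j × ρ j ≡ f))

  Language : Pred (ℕ → Letter COL) 0ℓ
  Language σ = ∃[ q₀ ] q₀ ∈ Q₀ × Δω q₀ σ

  _∼*_ : List (Letter COL) → List (Letter COL) → Set
  σ ∼* σ′ = ∀ p q b → Δ* p σ q b ⇔ Δ* p σ′ q b

  _∼ω_ : (ℕ → Letter COL) → (ℕ → Letter COL) → Set
  σ ∼ω σ′ = ∀ p → Δω p σ ⇔ Δω p σ′

SetEquivalent : {A : Set} → (A → A → Set) → Pred A 0ℓ → Pred A 0ℓ → Set
SetEquivalent _∼_ S S′ = (∀ σ  → σ  ∈ S  → ∃[ σ′ ] σ′ ∈ S′ × σ ∼ σ′)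
                       × (∀ σ′ → σ′ ∈ S′ → ∃[ σ ]  σ  ∈ S  × σ ∼ σ′)

------------------------------------------------------------------------
-- Traces

module _ {ACT COL : Set} {LAB : Set a} (H : HG ACT COL LAB n) where

  -- Path u p̄ v: the sequence u p̄ v is a path; it has at least one edge.
  data Path : W H → List (V H) → W H → Set where
    edge : ∀ {u v} → _⟶_ H u v → Path u [] v
    step : ∀ {u x p̄ v} → _⟶_ H u (inj₁ x) → Path (inj₁ x) p̄ v → Path u (x ∷ p̄) v

  colours : List (V H) → List (Letter COL)
  colours = map (γ H)

  Traces* : W H → W H → Pred (List (Letter COL)) 0ℓ
  Traces* u v σ = ∃[ p̄ ] Path u p̄ v × σ ≡ colours (concrete H u ++ p̄ ++ concrete H v)

  Pathω : W H → (ℕ → V H) → Set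
  Pathω u p̄ = _⟶_ H u (inj₁ (p̄ 0)) × (∀ i → _⟶_ H (inj₁ (p̄ i)) (inj₁ (p̄ (suc i))))

  concreteω : W H → (ℕ → V H) → (ℕ → V H)
  concreteω (inj₁ u) p̄ zero    = u
  concreteω (inj₁ u) p̄ (suc i) = p̄ i
  concreteω (inj₂ _) p̄         = p̄

  Tracesω : W H → Pred (ℕ → Letter COL) 0ℓ
  Tracesω u σ = ∃[ p̄ ] Pathω u p̄ × σ ≗ γ H ∘ concreteω u p̄

  _⊨_ : W H → Büchi COL → Set
  v ⊨ M = Tracesω v ⊆′ Büchi.Language M

------------------------------------------------------------------------
-- 𝓜-equivalence with empty view

module _ {ACT COL : Set} {LAB : Set a} (H : HG ACT COL LAB n) where

  data Exposed : W H → Set where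
    abstr    : ∀ i → Exposed (inj₂ i)
    attached : ∀ e i → Exposed (α H e i)

  𝕏 : Setoid 0ℓ 0ℓ
  𝕏 = On.setoid (setoid (W H)) (proj₁ {B = Exposed})

module _ {COL : Set} (M : Büchi COL) where
  open Büchi M

  record Equivalent {ACT : Set} {LAB : Set a} {LAB′ : Set b}
                    (H : HG ACT COL LAB n) (H′ : HG ACT COL LAB′ n′) : Set where
    field
      n≡ : n ≡ n′
      μ  : E H ↔ E H′
      ν  : Inverse (𝕏 H) (𝕏 H′)

    onE : E H → E H′
    onE = Inverse.to μ

    onX : Setoid.Carrier (𝕏 H) → W H′
    onX x = proj₁ (Inverse.to ν x)

    field
      ν-abstr    : ∀ i → onX (_ , abstr i) ≡ inj₂ (cast n≡ i)
      len≡       : ∀ e → len H e ≡ len H′ (onE e)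
      ν-attached : ∀ e i → onX (_ , attached e i) ≡ α H′ (onE e) (cast (len≡ e) i)
      traces*    : ∀ x y → SetEquivalent _∼*_ (Traces* H (proj₁ x) (proj₁ y))
                                              (Traces* H′ (onX x) (onX y))
      tracesω    : ∀ x → SetEquivalent _∼ω_ (Tracesω H (proj₁ x)) (Tracesω H′ (onX x))
      -- The colour of an attached concrete node, as a one-letter word.  The
      -- traces do not determine it: if no edge of H touches the node, it occurs
      -- on no trace of H, but it does occur on traces of hypergraphs H[K].
      -- Replacement is compatible with the equivalence only with this clause.
      -- (At abstract nodes both words are empty.)
      colour     : ∀ x → colours H (concrete H (proj₁ x)) ∼* colours H′ (concrete H′ (onX x))

------------------------------------------------------------------------
-- Refinement and recolouring

-- An equivalence class is given by a representative, and equality of classes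
-- is Equivalent M.  Rules are stated up to this equality, so the choice of
-- representatives in nonterminals does not matter.
module Recolouring {ACT COL : Set} (G : HRG ACT COL) (M : Büchi COL) where
  open HRG G
  open Derivation grammar

  private
    HGᴳ : ℕ → Set₁
    HGᴳ = HG ACT COL N

    _≡ᴹ_ : HGᴳ n → HGᴳ n′ → Set
    _≡ᴹ_ = Equivalent M

  record Refined (A : N) : Set₁ where
    field
      𝔰       : HGᴳ (ar A)
      𝔰-class : Σ[ H ∈ HGᴳ (ar A) ] H ∈ 𝓛[ A ] × 𝔰 ≡ᴹ H
      {size}  : ℕ
      𝔠       : HGᴳ size
      𝔠-class : Σ[ J ∈ HGᴳ size ] J ∈ 𝓒[ A ] × 𝔠 ≡ᴹ J
      -- Implied by 𝔠-class; kept as a field so that 𝔠 can be plugged.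
      𝔠-hole  : OneHole 𝔠 (ar A)

  open Refined

  N≡ : Set₁
  N≡ = Σ N Refined

  ar≡ : N≡ → ℕ
  ar≡ (A , _) = ar A

  Z≡ : Pred N≡ 0ℓ
  Z≡ (A , X) = A ∈ Z × 𝔠 X ≡ᴹ handle A (ar A)

  module _ {A : N} (r : P A) where

    private
      𝓡 : HGᴳ (ar A)
      𝓡 = rhs r

    Assignment : Set₁
    Assignment = (e : E 𝓡) → HGᴳ (ar (ℓ 𝓡 e))

    _⟦_⟧ : Assignment → HGᴳ (ar A)
    _⟦_⟧ t = replace 𝓡 t (λ e → sym (rank r e))

    handleAt : Assignment → E 𝓡 → Assignment
    handleAt t e e′ with _≟E_ 𝓡 e′ e
    ... | yes _ = handle (ℓ 𝓡 e′) (ar (ℓ 𝓡 e′))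
    ... | no  _ = t e′

  record P≡ (AX : N≡) : Set₁ where
    private
      A = proj₁ AX
      X = proj₂ AX
    field
      r : P A
      l : (e : E (rhs r)) → Refined (ℓ (rhs r) e)

    𝔱 : Assignment r
    𝔱 e = 𝔰 (l e)

    field
      𝔰≡ : 𝔰 X ≡ᴹ (r ⟦ 𝔱 ⟧)
      𝔡≡ : ∀ e → 𝔠 (l e) ≡ᴹ plug (𝔠 X) (𝔠-hole X) (r ⟦ handleAt r 𝔱 e ⟧)

    rhs≡ : HG ACT COL N≡ (ar A)
    rhs≡ = relabel (rhs r) (λ e → ℓ (rhs r) e , l e)

    whole : HGᴳ (size X)
    whole = plug (𝔠 X) (𝔠-hole X) (r ⟦ 𝔱 ⟧)

    inWhole : V (rhs r) → V whole
    inWhole v = inj₂ (OneHole.hole (𝔠-hole X) , inj₁ v)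

  G≡ : Grammar ACT COL (lsuc 0ℓ)
  G≡ = record
    { N = N≡ ; ar = ar≡ ; Z = Z≡ ; P = P≡
    ; rhs  = P≡.rhs≡
    ; rank = λ ρ → rank (P≡.r ρ)
    }

  COLᴹ : Set
  COLᴹ = COL ⊎ ⊤

  𝓜 : COLᴹ
  𝓜 = inj₂ tt

  record Pᴹ (AX : N≡) : Set₁ where
    field
      rule   : P≡ AX
    open P≡ rule
    field
      mark   : V (rhs r) → Bool
      mark-⊨ : ∀ v → mark v ≡ true ⇔ _⊨_ whole (inj₁ (inWhole v)) M

    rhsᴹ : HG ACT COLᴹ N≡ (ar≡ AX)
    rhsᴹ = recolour rhs≡ (λ v → [ γ (rhs r) v , const (mark v) ])

  Gᴹ : Grammar ACT COLᴹ (lsuc 0ℓ)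
  Gᴹ = record
    { N = N≡ ; ar = ar≡ ; Z = Z≡ ; P = Pᴹ
    ; rhs  = Pᴹ.rhsᴹ
    ; rank = λ ρ → rank (P≡.r (Pᴹ.rule ρ))
    }

  delete𝓜 : {LAB : Set a} → HG ACT COLᴹ LAB n → HG ACT COL LAB n
  delete𝓜 H = recolour H (λ v → γ H v ∘ inj₁)

{-# OPTIONS --safe #-}

-- Call two hypergraphs bisimilar when some of their nodes are matched such that the
-- sets of traces between matched nodes, and from matched nodes, are 𝓜-equivalent.
-- 𝓜-equivalence with empty view is the case where the exposed nodes are matched.  The
-- key fact is that bisimilarity is a congruence for replacement, in both arguments and
-- with all matched nodes remaining matched: a path of H[K] is cut, at nodes attached to
-- hyperedges, into paths of H and paths of the K(e), which are simulated one by one.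
--
-- By induction on a derivation tree T of (A, 𝔰, 𝔠), the assembled hypergraph is
-- bisimilar to 𝔰.  By induction on T again, now with a hypergraph D bisimilar to 𝔠 as
-- surroundings, a node of T is marked iff it satisfies 𝓜 in D[T]: for a node of the
-- root rule R the mark was computed in 𝔠[R[𝔱]], which is bisimilar to D[T] with the
-- nodes of R matched; and passing to the subtree at e replaces D by D[R[𝔱⟨e/B(e)°⟩]],
-- which is bisimilar to 𝔡(e).

module Submission where

open import Defs hiding (_⊔_; colours)
open import Axiom.UniquenessOfIdentityProofs using (module Decidable⇒UIP)
open import Data.Empty using (⊥; ⊥-elim)
open import Data.Fin.Base using (Fin; zero; suc; toℕ; cast)
open import Data.Fin.Properties using (toℕ-cast; toℕ-injective; cast-is-id)
open import Data.List.Base using (List; []; _∷_; _++_; length; map)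
open import Data.List.Properties using (map-++; map-∘; ++-assoc; ++-identityʳ)
open import Data.Nat.Base using (ℕ; zero; suc; _+_; _∸_; _≤_; _⊔_; z≤n; s≤s)
open import Data.Nat.Properties
  using (≤-refl; ≤-trans; ≤-reflexive; +-suc; +-assoc; +-identityʳ; +-comm; m∸n+n≡m; m≤m+n; m≤n+m;
         +-monoʳ-≤; +-cancelʳ-≤; m≤m⊔n; m≤n⊔m; ≰⇒≥; _≤?_; m≤n⇒m≤1+n; n≤1+n; m+n≤o⇒m≤o; m≤n⇒m<n∨m≡n)
import Data.Sum.Base as Sum
open import Data.Sum.Properties using (inj₁-injective)
open import Function.Base using (_∘_; id; flip)
open import Function.Bundles using (Equivalence; mk⇔)
open import Function.Construct.Composition using (_⇔-∘_)
open import Function.Construct.Symmetry using (⇔-sym)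
open import Function.Properties.Inverse using (↔-refl)
open import Level using (Lift; lift)
open import Relation.Binary.PropositionalEquality using (subst₂; cong₂)

-- Words and runs

-- Adjacent pieces of a cut path share the node at the cut, so its letter occurs in both words, and
-- exchanging the pieces is not just congruence of concatenation. After one piece is exchanged, the
-- shared letter is turned back before the next exchange; this is why matched nodes must agree in
-- colour. With infinitely many cuts no finite number of such repairs suffices, and acceptance has
-- to be transferred along all blocks at once. Exposed nodes are too few for the induction: a mark
-- concerns a concrete node of a right side, and an attached node may no longer be exposed once its
-- hyperedge is replaced. Hence the matching may involve any nodes. The siblings of a subtree are
-- assembled from their actual derivations, whereas `𝔡≡` speaks of the representatives `𝔱`. Carrying
-- an arbitrary `D` bisimilar to `𝔠` bridges this gap at every level of the tree. Excluded middle
-- decides whether a run visits `F` and whether a path meets matched nodes infinitely often.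

private variable
  A B : Set

infixr 5 _++ω_

_++ω_ : List A → (ℕ → A) → (ℕ → A)
([]      ++ω τ) i       = τ i
((x ∷ σ) ++ω τ) zero    = x
((x ∷ σ) ++ω τ) (suc i) = (σ ++ω τ) i

++ω-cong : ∀ (σ : List A) {τ τ′} → τ ≗ τ′ → σ ++ω τ ≗ σ ++ω τ′
++ω-cong []      τ≗ i       = τ≗ i
++ω-cong (_ ∷ _) τ≗ zero    = refl
++ω-cong (_ ∷ σ) τ≗ (suc i) = ++ω-cong σ τ≗ i

++ω-assoc : ∀ (σ σ′ : List A) τ → (σ ++ σ′) ++ω τ ≗ σ ++ω σ′ ++ω τ
++ω-assoc []      σ′ τ i       = refl
++ω-assoc (_ ∷ σ) σ′ τ zero    = refl
++ω-assoc (_ ∷ σ) σ′ τ (suc i) = ++ω-assoc σ σ′ τ i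

++ω-drop : ∀ (σ : List A) τ i → (σ ++ω τ) (i + length σ) ≡ τ i
++ω-drop []      τ i = cong τ (+-identityʳ i)
++ω-drop (_ ∷ σ) τ i rewrite +-suc i (length σ) = ++ω-drop σ τ i

map-++ω : ∀ (f : A → B) σ τ → f ∘ (σ ++ω τ) ≗ map f σ ++ω f ∘ τ
map-++ω f []      τ i       = refl
map-++ω f (_ ∷ σ) τ zero    = refl
map-++ω f (_ ∷ σ) τ (suc i) = map-++ω f σ τ i

-- A block is given as a head and a tail, hence is nonempty: every step of the recursion on the
-- position emits one element. In `go a l k` the current element is `a`, the rest of its block is
-- `l`, and `k` is the next block.
module Concat (h : ℕ → A) (t : ℕ → List A) where

  private
    go : A → List A → ℕ → (ℕ → A)
    go a l       k zero    = a
    go a (b ∷ l) k (suc i) = go b l k i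
    go a []      k (suc i) = go (h k) (t k) (suc k) i

  concat : ℕ → (ℕ → A)
  concat k = go (h k) (t k) (suc k)

  concat-unfold : ∀ k → concat k ≗ (h k ∷ t k) ++ω concat (suc k)
  concat-unfold k = go-unfold (h k) (t k) (suc k)
    where
    go-unfold : ∀ a l k → go a l k ≗ (a ∷ l) ++ω concat k
    go-unfold a l       k zero    = refl
    go-unfold a (b ∷ l) k (suc i) = go-unfold b l k i
    go-unfold a []      k (suc i) = refl

open Concat public

-- The preimage found at one position is what `next` needs at the following one. This pulls an
-- infinite path of a replacement that never leaves one component back into that component, with `f`
-- the embedding and `_R_` the edge relation.
follow : (f : A → B) (_R_ : A → A → Set) (p : ℕ → B) →
         (∀ i a → p i ≡ f a → ∃[ a′ ] p (suc i) ≡ f a′ × a R a′) →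
         ∀ a → p 0 ≡ f a →
         ∃[ q ] q 0 ≡ a × (∀ i → p i ≡ f (q i)) × (∀ i → q i R q (suc i))
follow f _R_ p next a e = proj₁ ∘ seq , refl , proj₂ ∘ seq ,
  λ i → proj₂ (proj₂ (next i (proj₁ (seq i)) (proj₂ (seq i))))
  where
  seq : ∀ i → ∃[ a ] p i ≡ f a
  seq zero    = a , e
  seq (suc i) = let (a′ , e′ , _) = next i (proj₁ (seq i)) (proj₂ (seq i)) in a′ , e′

InfinitelyOften : (ℕ → Set) → Set
InfinitelyOften P = ∀ i → ∃[ j ] i ≤ j × P j

often-drop : ∀ {P} → InfinitelyOften P → ∀ k → InfinitelyOften (λ j → P (j + k))
often-drop {P} often k i with often (i + k)
... | j , i≤j , x = j ∸ k , +-cancelʳ-≤ k i _ (≤-trans i≤j (≤-reflexive (sym j≡))) , subst P (sym j≡) x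
  where
  j≡ : j ∸ k + k ≡ j
  j≡ = m∸n+n≡m (≤-trans (m≤n+m k i) i≤j)

lower-em : ExcludedMiddle (lsuc 0ℓ) → ExcludedMiddle 0ℓ
lower-em em {P} with em {Lift (lsuc 0ℓ) P}
... | yes (lift p) = yes p
... | no ¬p              = no (λ p → ¬p (lift p))

map₁-id : (x : A ⊎ B) → Sum.map₁ (λ y → y) x ≡ x
map₁-id (inj₁ _) = refl
map₁-id (inj₂ _) = refl

module Words (em : ExcludedMiddle 0ℓ) {COL : Set} (M : Büchi COL) where
  open Büchi M

  private variable
    p q r : Q
    σ σ′ σ″ τ τ′ : List (Letter COL)
    ω ω′ ω″ : ℕ → Letter COL

  em-¬∀ : {P : A → Set} → ¬ (∀ x → P x) → ∃[ x ] ¬ P x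
  em-¬∀ {A = A} {P = P} ¬∀ with em {∃[ x ] ¬ P x}
  ... | yes x = x
  ... | no ¬∃ = ⊥-elim (¬∀ all)
    where
    all : ∀ x → P x
    all x with em {P x}
    ... | yes px = px
    ... | no ¬px = ⊥-elim (¬∃ (x , ¬px))

  -- The result is the proof chosen by `em`, so the function is constant even if `P` has many
  -- proofs.
  canonical : {P : Set} → P → P
  canonical {P = P} x with em {P}
  ... | yes y = y
  ... | no ¬x = x

  canonical-const : {P : Set} (x y : P) → canonical x ≡ canonical y
  canonical-const {P = P} x y with em {P}
  ... | yes _ = refl
  ... | no ¬x = ⊥-elim (¬x x)

  -- Equivalence of finite words

  infixr 5 _++ʳ_

  _++ʳ_ : Run p σ q → Run q τ r → Run p (σ ++ τ) r
  []      ++ʳ π = π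
  (δ ∷ ρ) ++ʳ π = δ ∷ (ρ ++ʳ π)

  data SplitRun {p} σ τ {r} : Run p (σ ++ τ) r → Set where
    split : (ρ : Run p σ q) (π : Run q τ r) → SplitRun σ τ (ρ ++ʳ π)

  splitRun : ∀ σ (ρ : Run p (σ ++ τ) r) → SplitRun σ τ ρ
  splitRun []      ρ       = split [] ρ
  splitRun (_ ∷ σ) (δ ∷ ρ) with splitRun σ ρ
  ... | split ρ₁ ρ₂ = split (δ ∷ ρ₁) ρ₂

  visits-start : p ∈ F → (ρ : Run p σ q) → Visits ρ
  visits-start f []      = last f
  visits-start f (_ ∷ _) = here f

  visits-++ : (ρ : Run p σ q) (π : Run q τ r) → Visits (ρ ++ʳ π) ⇔ (Visits ρ ⊎ Visits π)
  visits-++ ρ π = mk⇔ (to ρ π) [ from₁ ρ π , from₂ ρ π ]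
    where
    to : (ρ : Run p σ q) (π : Run q τ r) → Visits (ρ ++ʳ π) → Visits ρ ⊎ Visits π
    to []      π v         = inj₂ v
    to (_ ∷ _) π (here f)  = inj₁ (here f)
    to (_ ∷ ρ) π (there v) = [ inj₁ ∘ there , inj₂ ] (to ρ π v)

    from₁ : (ρ : Run p σ q) (π : Run q τ r) → Visits ρ → Visits (ρ ++ʳ π)
    from₁ []      π (last f)  = visits-start f π
    from₁ (_ ∷ _) π (here f)  = here f
    from₁ (_ ∷ ρ) π (there v) = there (from₁ ρ π v)

    from₂ : (ρ : Run p σ q) (π : Run q τ r) → Visits π → Visits (ρ ++ʳ π)
    from₂ []      π v = v
    from₂ (_ ∷ ρ) π v = there (from₂ ρ π v)

  infix 4 _≼_ _≈_ _≈ω_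

  _≼_ : List (Letter COL) → List (Letter COL) → Set
  σ ≼ σ′ = ∀ {p q} (ρ : Run p σ q) → Σ[ ρ′ ∈ Run p σ′ q ] (Visits ρ ⇔ Visits ρ′)

  -- A rephrasing of _∼*_, wrapped in a record so that the words can be inferred.
  record _≈_ (σ σ′ : List (Letter COL)) : Set where
    constructor mk≈
    field
      fwd : σ ≼ σ′
      bwd : σ′ ≼ σ

  -- `Δ*` reports visits as a Boolean, so `Visits ρ` must be decided before `ρ` can be fed to the
  -- hypothesis.
  ∼*⇒≈ : σ ∼* σ′ → σ ≈ σ′
  ∼*⇒≈ {σ} {σ′} σ∼σ′ = mk≈ (half (λ p q b → Equivalence.to (σ∼σ′ p q b)))
                           (half (λ p q b → Equivalence.from (σ∼σ′ p q b)))
    where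
    bit : (P : Set) → ∃[ b ] (b ≡ true ⇔ P)
    bit P with em {P}
    ... | yes x = true , mk⇔ (λ _ → x) (λ _ → refl)
    ... | no ¬x = false , mk⇔ (λ ()) (⊥-elim ∘ ¬x)

    half : ∀ {σ σ′} → (∀ p q b → Δ* p σ q b → Δ* p σ′ q b) → σ ≼ σ′
    half f {p} {q} ρ with bit (Visits ρ)
    ... | b , e with f p q b (ρ , e)
    ... | ρ′ , e′ = ρ′ , mk⇔ (Equivalence.to e′ ∘ Equivalence.from e)
                             (Equivalence.to e ∘ Equivalence.from e′)

  ≈-refl : σ ≈ σ
  ≈-refl = mk≈ (λ ρ → ρ , mk⇔ id id) (λ ρ → ρ , mk⇔ id id)

  ≈-reflexive : σ ≡ σ′ → σ ≈ σ′
  ≈-reflexive refl = ≈-refl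

  ≈-sym : σ ≈ σ′ → σ′ ≈ σ
  ≈-sym (mk≈ f g) = mk≈ g f

  ≈-trans : σ ≈ σ′ → σ′ ≈ σ″ → σ ≈ σ″
  ≈-trans (mk≈ f g) (mk≈ f′ g′) = mk≈ (half f f′) (half g′ g)
    where
    half : ∀ {σ σ′ σ″} → σ ≼ σ′ → σ′ ≼ σ″ → σ ≼ σ″
    half f g ρ = let (ρ′ , e) = f ρ ; (ρ″ , e′) = g ρ′ in
      ρ″ , mk⇔ (Equivalence.to e′ ∘ Equivalence.to e) (Equivalence.from e ∘ Equivalence.from e′)

  -- The state at which a run is split is an endpoint of both halves, so the whole run visits `F`
  -- exactly when one of the halves does.
  ++-cong : σ ≈ σ′ → τ ≈ τ′ → σ ++ τ ≈ σ′ ++ τ′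
  ++-cong (mk≈ f g) (mk≈ f′ g′) = mk≈ (half f f′) (half g g′)
    where
    half : ∀ {σ σ′ τ τ′} → σ ≼ σ′ → τ ≼ τ′ → σ ++ τ ≼ σ′ ++ τ′
    half {σ} f g ρ with splitRun σ ρ
    ... | split ρ₁ ρ₂ = let (ρ₁′ , e₁) = f ρ₁ ; (ρ₂′ , e₂) = g ρ₂ in
      ρ₁′ ++ʳ ρ₂′ ,
      mk⇔ (Equivalence.from (visits-++ ρ₁′ ρ₂′) ∘
           [ inj₁ ∘ Equivalence.to e₁ , inj₂ ∘ Equivalence.to e₂ ] ∘
           Equivalence.to (visits-++ ρ₁ ρ₂))
          (Equivalence.from (visits-++ ρ₁ ρ₂) ∘
           [ inj₁ ∘ Equivalence.from e₁ , inj₂ ∘ Equivalence.from e₂ ] ∘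
           Equivalence.to (visits-++ ρ₁′ ρ₂′))

  -- Letters are functions that agree only pointwise, so the two words need not be equal in the
  -- sense of `_≡_`; `Δ-resp` carries the runs over.
  letterwise : {f g : A → Letter COL} → (∀ x → f x ≗ g x) → ∀ w → map f w ≈ map g w
  letterwise f≗g w = mk≈ (half f≗g w) (half (λ x c → sym (f≗g x c)) w)
    where
    half : {f g : A → Letter COL} → (∀ x → f x ≗ g x) → ∀ w → map f w ≼ map g w
    half f≗g []      []      = [] , mk⇔ id id
    half f≗g (x ∷ w) (δ ∷ ρ) = let (ρ′ , e) = half f≗g w ρ in
      Δ-resp (f≗g x) δ ∷ ρ′ ,
      mk⇔ (λ { (here f) → here f ; (there v) → there (Equivalence.to e v) })
          (λ { (here f) → here f ; (there v) → there (Equivalence.from e v) })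

  -- The first exchange yields y′, which is turned back into y to allow the second one.
  overlap-≈ : ∀ (x x′ p p′ y y′ w w′ : List (Letter COL)) →
              y ≈ y′ → x ++ p ++ y ≈ x′ ++ p′ ++ y′ → y ++ w ≈ y′ ++ w′ →
              x ++ p ++ y ++ w ≈ x′ ++ p′ ++ y′ ++ w′
  overlap-≈ x x′ p p′ y y′ w w′ y≈ xpy≈ yw≈ =
    ≈-trans (≈-reflexive (reassoc x p y w))
    (≈-trans (++-cong xpy≈ ≈-refl)
    (≈-trans (≈-reflexive (sym (reassoc x′ p′ y′ w)))
    (++-cong (≈-refl {x′}) (++-cong (≈-refl {p′})
      (≈-trans (++-cong (≈-sym y≈) ≈-refl) yw≈)))))
    where
    reassoc : ∀ (x p y w : List (Letter COL)) → x ++ p ++ y ++ w ≡ (x ++ p ++ y) ++ w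
    reassoc x p y w = trans (cong (x ++_) (sym (++-assoc p y w))) (sym (++-assoc x (p ++ y) w))

  -- Equivalence of infinite words

  record _≈ω_ (ω ω′ : ℕ → Letter COL) : Set where
    constructor mk≈ω
    field
      ∼ω : ω ∼ω ω′

  open _≈ω_ public

  Δω-resp : (∀ i → ω i ≗ ω′ i) → Δω p ω → Δω p ω′
  Δω-resp ω≗ (ρ , ρ₀ , δ , inf) = ρ , ρ₀ , (λ i → Δ-resp (ω≗ i) (δ i)) , inf

  pointwise⇒≈ω : (∀ i → ω i ≗ ω′ i) → ω ≈ω ω′
  pointwise⇒≈ω ω≗ = mk≈ω λ p → mk⇔ (Δω-resp ω≗) (Δω-resp λ i c → sym (ω≗ i c))

  ≗⇒≈ω : ω ≗ ω′ → ω ≈ω ω′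
  ≗⇒≈ω ω≗ = pointwise⇒≈ω λ i c → cong (λ x → x c) (ω≗ i)

  ≈ω-refl : ω ≈ω ω
  ≈ω-refl = ≗⇒≈ω (λ _ → refl)

  ≈ω-sym : ω ≈ω ω′ → ω′ ≈ω ω
  ≈ω-sym (mk≈ω e) = mk≈ω λ p → mk⇔ (Equivalence.from (e p)) (Equivalence.to (e p))

  ≈ω-trans : ω ≈ω ω′ → ω′ ≈ω ω″ → ω ≈ω ω″
  ≈ω-trans (mk≈ω e) (mk≈ω e′) = mk≈ω λ p →
    mk⇔ (Equivalence.to (e′ p) ∘ Equivalence.to (e p))
        (Equivalence.from (e p) ∘ Equivalence.from (e′ p))

  Δω-unfold : Δω p ω → ∃[ q ] Δ p (ω 0) q × Δω q (ω ∘ suc)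
  Δω-unfold (ρ , refl , δ , f , f∈F , inf) = ρ 1 , δ 0 , ρ ∘ suc , refl , δ ∘ suc , f , f∈F , inf′
    where
    inf′ : ∀ i → ∃[ j ] i ≤ j × ρ (suc j) ≡ f
    inf′ i with inf (suc i)
    ... | suc j , s≤s i≤j , e = j , i≤j , e

  Δω-fold : Δ p (ω 0) q → Δω q (ω ∘ suc) → Δω p ω
  Δω-fold {p} {ω} δ₀ (ρ , refl , δ , f , f∈F , inf) = ρ′ , refl , δ′ , f , f∈F , inf′
    where
    ρ′ : ℕ → Q
    ρ′ zero    = p
    ρ′ (suc i) = ρ i
    δ′ : ∀ i → Δ (ρ′ i) (ω i) (ρ′ (suc i))
    δ′ zero    = δ₀
    δ′ (suc i) = δ i
    inf′ : ∀ i → ∃[ j ] i ≤ j × ρ′ j ≡ f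
    inf′ i = let (j , i≤j , e) = inf i in suc j , m≤n⇒m≤1+n i≤j , e

  Δω-split : ∀ σ → Δω p (σ ++ω ω) → ∃[ q ] Run p σ q × Δω q ω
  Δω-split []      d = _ , [] , d
  Δω-split (_ ∷ σ) d with Δω-unfold d
  ... | _ , δ , d′ with Δω-split σ d′
  ... | q , ρ , d″ = q , δ ∷ ρ , d″

  Δω-prepend : Run p σ q → Δω q ω → Δω p (σ ++ω ω)
  Δω-prepend []      d = d
  Δω-prepend (δ ∷ ρ) d = Δω-fold δ (Δω-prepend ρ d)

  ++ω-≈ : σ ≈ σ′ → ω ≈ω ω′ → σ ++ω ω ≈ω σ′ ++ω ω′
  ++ω-≈ {σ} {σ′} (mk≈ f g) (mk≈ω e) = mk≈ω λ _ →
    mk⇔ (half f (λ p → Equivalence.to (e p))) (half g (λ p → Equivalence.from (e p)))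
    where
    half : ∀ {σ σ′ p ω ω′} → σ ≼ σ′ → (∀ p → Δω p ω → Δω p ω′) → Δω p (σ ++ω ω) → Δω p (σ′ ++ω ω′)
    half {σ} f g d with Δω-split σ d
    ... | q , ρ , d′ = Δω-prepend (proj₁ (f ρ)) (g q d′)

  overlapω : ∀ (x x′ p p′ y y′ : List (Letter COL)) →
             y ≈ y′ → x ++ p ++ y ≈ x′ ++ p′ ++ y′ → y ++ω ω ≈ω y′ ++ω ω′ →
             x ++ω p ++ω y ++ω ω ≈ω x′ ++ω p′ ++ω y′ ++ω ω′
  overlapω {ω} {ω′} x x′ p p′ y y′ y≈ xpy≈ yω≈ =
    ≈ω-trans (reassoc x p y)
    (≈ω-trans (++ω-≈ xpy≈ ≈ω-refl)
    (≈ω-trans (≈ω-sym (reassoc x′ p′ y′))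
    (++ω-≈ (≈-refl {x′}) (++ω-≈ (≈-refl {p′})
      (≈ω-trans (++ω-≈ (≈-sym y≈) ≈ω-refl) yω≈)))))
    where
    reassoc : ∀ (x p y : List (Letter COL)) → x ++ω p ++ω y ++ω ω ≈ω (x ++ p ++ y) ++ω ω
    reassoc x p y = ≈ω-sym (≗⇒≈ω (λ i →
      trans (++ω-assoc x (p ++ y) ω i) (++ω-cong x (++ω-assoc p y ω) i)))

  -- `Δω` wants a single recurring state, whereas gluing runs yields visits to varying states of
  -- `F`. The finitely many candidates are tried in turn; one that does not recur is discarded by
  -- looking only beyond its last occurrence.
  pigeonhole : (ρ : ℕ → Q) → InfinitelyOften (λ j → ρ j ∈ F) →
               ∃[ f ] f ∈ F × InfinitelyOften (λ j → ρ j ≡ f)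
  pigeonhole ρ inf = go (proj₁ Q-finite) (Inverse.from Q↔) λ i →
    let (j , i≤j , j∈F) = inf i in
    j , i≤j , j∈F , Inverse.to Q↔ (ρ j) , sym (Inverse.strictlyInverseʳ Q↔ (ρ j))
    where
    Q↔ = proj₂ Q-finite

    go : ∀ n (g : Fin n → Q) →
         InfinitelyOften (λ j → ρ j ∈ F × ∃[ x ] ρ j ≡ g x) →
         ∃[ f ] f ∈ F × InfinitelyOften (λ j → ρ j ≡ f)
    go zero    g inf with inf 0
    ... | _ , _ , _ , () , _
    go (suc n) g inf with em {InfinitelyOften (λ j → ρ j ∈ F × ρ j ≡ g zero)}
    ... | yes often = g zero , subst F (proj₂ (proj₂ (proj₂ (often 0)))) (proj₁ (proj₂ (proj₂ (often 0))))
                    , λ i → let (j , i≤j , _ , e) = often i in j , i≤j , e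
    ... | no ¬often with em-¬∀ ¬often
    ...   | N , late = go n (g ∘ suc) inf′
      where
      inf′ : InfinitelyOften (λ j → ρ j ∈ F × ∃[ x ] ρ j ≡ g (suc x))
      inf′ i with inf (i ⊔ N)
      ... | j , i≤j , j∈F , zero  , e = ⊥-elim (late (j , ≤-trans (m≤n⊔m i N) i≤j , j∈F , e))
      ... | j , i≤j , j∈F , suc x , e = j , ≤-trans (m≤m⊔n i N) i≤j , j∈F , x , e

  -- `ω k` is the suffix that begins with block `k`. Speaking of all suffixes at once avoids
  -- computing the positions of the blocks.
  IsConcat : (h : ℕ → Letter COL) (t : ℕ → List (Letter COL)) → (ℕ → ℕ → Letter COL) → Set
  IsConcat h t ω = ∀ k → ω k ≗ (h k ∷ t k) ++ω ω (suc k)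

  BlockRuns : (h : ℕ → Letter COL) (t : ℕ → List (Letter COL)) → Q → Set
  BlockRuns h t p = Σ[ q ∈ (ℕ → Q) ] q 0 ≡ p ×
    (Σ[ ρ ∈ (∀ k → Run (q k) (h k ∷ t k) (q (suc k))) ] InfinitelyOften (λ k → Visits (ρ k)))

  module _ {h : ℕ → Letter COL} {t : ℕ → List (Letter COL)} {ω : ℕ → ℕ → Letter COL}
           (ω≗ : IsConcat h t ω) where

    private
      block : ℕ → List (Letter COL)
      block k = h k ∷ t k

    cutRun : Δω p (ω 0) → BlockRuns h t p
    cutRun (ρ , ρ₀ , δ , f , f∈F , inf) =
      (λ k → ρᵏ k 0) , ρ₀ , (λ k → prefix (block k) (ρᵏ k) (δ′ k)) ,
      λ i → let (j , _ , e) = infᵏ i 0 in visit j j i ≤-refl (subst F (sym e) f∈F)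
      where
      ρᵏ : ℕ → ℕ → Q
      ρᵏ zero    = ρ
      ρᵏ (suc k) = λ i → ρᵏ k (i + length (block k))

      δᵏ : ∀ k i → Δ (ρᵏ k i) (ω k i) (ρᵏ k (suc i))
      δᵏ zero    i = δ i
      δᵏ (suc k) i = Δ-resp
        (λ c → cong (λ x → x c) (trans (ω≗ k (i + length (block k))) (++ω-drop (block k) (ω (suc k)) i)))
        (δᵏ k (i + length (block k)))

      δ′ : ∀ k i → Δ (ρᵏ k i) ((block k ++ω ω (suc k)) i) (ρᵏ k (suc i))
      δ′ k i = Δ-resp (λ c → cong (λ x → x c) (ω≗ k i)) (δᵏ k i)

      infᵏ : ∀ k → InfinitelyOften (λ j → ρᵏ k j ≡ f)
      infᵏ zero    = inf
      infᵏ (suc k) = often-drop (infᵏ k) (length (block k))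

      prefix : ∀ w {ω} (ρ : ℕ → Q) → (∀ i → Δ (ρ i) ((w ++ω ω) i) (ρ (suc i))) →
               Run (ρ 0) w (ρ (length w))
      prefix []      ρ δ = []
      prefix (_ ∷ w) ρ δ = δ 0 ∷ prefix w (ρ ∘ suc) (δ ∘ suc)

      prefix-visits : ∀ w {ω} (ρ : ℕ → Q) (δ : ∀ i → Δ (ρ i) ((w ++ω ω) i) (ρ (suc i))) j →
                      j ≤ length w → ρ j ∈ F → Visits (prefix w ρ δ)
      prefix-visits w       ρ δ zero    _         f = visits-start f (prefix w ρ δ)
      prefix-visits (_ ∷ w) ρ δ (suc j) (s≤s j≤w) f = there (prefix-visits w (ρ ∘ suc) (δ ∘ suc) j j≤w f)

      -- `n` bounds `j` and makes the recursion terminate: a position beyond block `k` is looked up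
      -- from block `suc k` on, at a smaller offset because blocks are nonempty. Offset
      -- `length (block k)` still belongs to block `k`, as a run includes its last state.
      visit : ∀ n j k → j ≤ n → ρᵏ k j ∈ F →
              ∃[ k′ ] k ≤ k′ × Visits (prefix (block k′) (ρᵏ k′) (δ′ k′))
      visit n j k j≤n f with j ≤? length (block k)
      ... | yes j≤ = k , ≤-refl , prefix-visits (block k) (ρᵏ k) (δ′ k) j j≤ f
      visit zero    zero k j≤n f | no j≰ = ⊥-elim (j≰ z≤n)
      visit (suc n) j k j≤n f | no j≰ =
        let (k′ , k≤k′ , v) = visit n (j ∸ length (block k)) (suc k) smaller
                                (subst (λ j → ρᵏ k j ∈ F) (sym j≡) f)
        in  k′ , ≤-trans (n≤1+n k) k≤k′ , v
        where
        j≡ : j ∸ length (block k) + length (block k) ≡ j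
        j≡ = m∸n+n≡m (≰⇒≥ j≰)
        smaller : j ∸ length (block k) ≤ n
        smaller = m+n≤o⇒m≤o _ {length (t k)} (+-cancelʳ-≤ 1 _ n
          (≤-trans (≤-reflexive (trans (+-assoc _ (length (t k)) 1)
             (trans (cong (j ∸ length (block k) +_) (+-comm (length (t k)) 1)) j≡)))
             (≤-trans j≤n (≤-reflexive (+-comm 1 n)))))

    -- Each block contributes its states except the last, which is the first state of the next
    -- block. The state blocks are thus as long as the letter blocks, and both are concatenated in
    -- step.
    glueRuns : BlockRuns h t p → Δω p (ω 0)
    glueRuns (q , refl , ρ , inf) =
      S 0 , refl , (λ i → Δ-resp (λ c → cong (λ x → x c) (sym (ω≗ 0 i))) (δ₀ i)) , pigeonhole (S 0) inf′
      where
      states : Run p σ r → List Q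
      states []              = []
      states (_∷_ {p = p} _ ρ) = p ∷ states ρ

      tail : ∀ {x} → Run p (x ∷ σ) r → List Q
      tail (_ ∷ ρ) = states ρ

      S : ℕ → ℕ → Q
      S = concat q (λ k → tail (ρ k))

      advance : ∀ i {p x σ k} (ρ : Run p (x ∷ σ) (q k)) →
             Δ (((p ∷ tail ρ) ++ω S k) i) (((x ∷ σ) ++ω ω k) i) (((p ∷ tail ρ) ++ω S k) (suc i))
      advance zero            (δ ∷ [])      = δ
      advance zero            (δ ∷ (_ ∷ _)) = δ
      advance (suc i) {k = k} (_ ∷ [])
        rewrite concat-unfold q (λ k → tail (ρ k)) k i
              | concat-unfold q (λ k → tail (ρ k)) k (suc i)
              | ω≗ k i = advance i (ρ k)
      advance (suc i) (_ ∷ ρ@(_ ∷ _)) = advance i ρ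

      δ₀ : ∀ i → Δ (S 0 i) ((block 0 ++ω ω 1) i) (S 0 (suc i))
      δ₀ i rewrite concat-unfold q (λ k → tail (ρ k)) 0 i
                 | concat-unfold q (λ k → tail (ρ k)) 0 (suc i) = advance i (ρ 0)

      position : ∀ {x k} (ρ : Run p (x ∷ σ) (q k)) → Visits ρ → ∃[ j ] ((p ∷ tail ρ) ++ω S k) j ∈ F
      position (_ ∷ _)         (here f)         = 0 , f
      -- The final state `q k` of this run was left out of `tail`; it reappears as the head of the
      -- following block.
      position (_ ∷ [])        (there (last f)) = 1 , f
      position (_ ∷ ρ@(_ ∷ _)) (there v)        = let (j , f) = position ρ v in suc j , f

      -- Each of the first `k` blocks has length at least one, so offset `j` in the suffix lies at
      -- position `k + j` or later. This turns infinitely many visiting blocks into infinitely many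
      -- visiting positions.
      later : ∀ k j → ∃[ j′ ] k + j ≤ j′ × S 0 j′ ≡ S k j
      later zero    j = j , ≤-refl , refl
      later (suc k) j with later k (j + length (q k ∷ tail (ρ k)))
      ... | j′ , ≤j′ , e = j′
        , ≤-trans (≤-reflexive (sym (+-suc k j)))
            (≤-trans (+-monoʳ-≤ k (≤-trans (s≤s (m≤m+n j (length (tail (ρ k)))))
              (≤-reflexive (sym (+-suc j (length (tail (ρ k)))))))) ≤j′)
        , trans e (trans (concat-unfold q (λ k → tail (ρ k)) k (j + length (q k ∷ tail (ρ k))))
            (++ω-drop (q k ∷ tail (ρ k)) (S (suc k)) j))

      inf′ : InfinitelyOften (λ j → S 0 j ∈ F)
      inf′ i with inf i
      ... | k , i≤k , v with position (ρ k) v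
      ... | j , f with later k j
      ... | j′ , ≤j′ , e = j′ , ≤-trans i≤k (m+n≤o⇒m≤o k ≤j′)
        , subst F (sym (trans e (concat-unfold q (λ k → tail (ρ k)) k j))) f

  -- Büchi acceptance of a concatenation depends only on the end states of runs on the blocks and on
  -- which of these runs visit `F`; `≈` preserves both.
  concat-≈ω : ∀ {h h′ t t′ ω ω′} → IsConcat h t ω → IsConcat h′ t′ ω′ →
              (∀ k → h k ∷ t k ≈ h′ k ∷ t′ k) → ω 0 ≈ω ω′ 0
  concat-≈ω ω≗ ω′≗ ≈k = mk≈ω λ p → mk⇔
    (glueRuns ω′≗ ∘ transfer (λ k → _≈_.fwd (≈k k)) ∘ cutRun ω≗)
    (glueRuns ω≗ ∘ transfer (λ k → _≈_.bwd (≈k k)) ∘ cutRun ω′≗)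
    where
    transfer : ∀ {h h′ t t′ p} → (∀ k → h k ∷ t k ≼ h′ k ∷ t′ k) → BlockRuns h t p → BlockRuns h′ t′ p
    transfer f (q , q₀ , ρ , inf) = q , q₀ , (λ k → proj₁ (f k (ρ k))) , λ i →
      let (j , i≤j , v) = inf i in j , i≤j , Equivalence.to (proj₂ (f j (ρ j))) v

  -- Consecutive blocks overlap in a node letter, so they cannot be exchanged all at
  -- once: first the words v p z are exchanged, leaving the words q fixed, and then the
  -- words z q v.
  overlap-≈ω : ∀ {v z v′ z′ : ℕ → Letter COL} {p q p′ q′ : ℕ → List (Letter COL)}
    {ω ω′ : ℕ → ℕ → Letter COL} →
    IsConcat v (λ k → p k ++ z k ∷ q k) ω →
    IsConcat v′ (λ k → p′ k ++ z′ k ∷ q′ k) ω′ →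
    (∀ k → v k ∷ [] ≈ v′ k ∷ []) → (∀ k → z k ∷ [] ≈ z′ k ∷ []) →
    (∀ k → v k ∷ p k ++ z k ∷ [] ≈ v′ k ∷ p′ k ++ z′ k ∷ []) →
    (∀ k → z k ∷ q k ++ v (suc k) ∷ [] ≈ z′ k ∷ q′ k ++ v′ (suc k) ∷ []) →
    ω 0 ≈ω ω′ 0
  overlap-≈ω {v} {z} {v′} {z′} {p} {q} {p′} {q′} {ω} {ω′} ω≗ ω′≗ v≈ z≈ vpz≈ zqv≈ =
    ≈ω-trans (concat-≈ω ω≗ mid≗ λ k →
        ≈-trans (≈-reflexive (snoc (v k ∷ p k) (z k) (q k)))
        (≈-trans (++-cong (vpz≈ k) ≈-refl) (≈-reflexive (sym (snoc (v′ k ∷ p′ k) (z′ k) (q k))))))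
    (≈ω-trans (≗⇒≈ω (regroup q mid mid≗ 0))
    -- Both sides now begin with `v′ 0 ∷ p′ 0`. Setting it aside moves the cut points from the
    -- `v′ k` to the `z′ k`.
    (≈ω-trans (++ω-≈ (≈-refl {v′ 0 ∷ p′ 0})
        (concat-≈ω (shift q mid mid≗) (shift q′ ω′ ω′≗) λ k →
          ≈-trans (≈-reflexive (snoc (z′ k ∷ q k) (v′ (suc k)) (p′ (suc k))))
          (≈-trans (++-cong (zq≈ k) ≈-refl)
            (≈-reflexive (sym (snoc (z′ k ∷ q′ k) (v′ (suc k)) (p′ (suc k))))))))
    (≈ω-sym (≗⇒≈ω (regroup q′ ω′ ω′≗ 0)))))
    where
    mid : ℕ → ℕ → Letter COL
    mid = concat v′ (λ k → p′ k ++ z′ k ∷ q k)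

    mid≗ : IsConcat v′ (λ k → p′ k ++ z′ k ∷ q k) mid
    mid≗ = concat-unfold v′ (λ k → p′ k ++ z′ k ∷ q k)

    snoc : ∀ (x : List (Letter COL)) y w → x ++ y ∷ w ≡ (x ++ y ∷ []) ++ w
    snoc x y w = sym (++-assoc x (y ∷ []) w)

    zq≈ : ∀ k → z′ k ∷ q k ++ v′ (suc k) ∷ [] ≈ z′ k ∷ q′ k ++ v′ (suc k) ∷ []
    -- The letters around `q k` are already primed; they are turned back so that `zqv≈` applies.
    zq≈ k = ≈-trans (++-cong (≈-sym (z≈ k)) (++-cong (≈-refl {q k}) (≈-sym (v≈ (suc k))))) (zqv≈ k)

    regroup : ∀ q ω → IsConcat v′ (λ k → p′ k ++ z′ k ∷ q k) ω →
              ∀ k → ω k ≗ (v′ k ∷ p′ k) ++ω (z′ k ∷ q k) ++ω ω (suc k)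
    regroup q ω ω≗ k i = trans (ω≗ k i) (++ω-assoc (v′ k ∷ p′ k) (z′ k ∷ q k) (ω (suc k)) i)

    shift : ∀ q ω → IsConcat v′ (λ k → p′ k ++ z′ k ∷ q k) ω →
            IsConcat z′ (λ k → q k ++ v′ (suc k) ∷ p′ (suc k)) (λ k → (z′ k ∷ q k) ++ω ω (suc k))
    shift q ω ω≗ k i = trans (++ω-cong (z′ k ∷ q k) (regroup q ω ω≗ (suc k)) i)
      (sym (++ω-assoc (z′ k ∷ q k) (v′ (suc k) ∷ p′ (suc k)) _ i))

-- Traces and bisimilarity

-- Finiteness, actions and labels play no role for traces.
record Skeleton (COL : Set) (n : ℕ) : Set₁ where
  field
    V E : Set

  W : Set
  W = V ⊎ Fin n

  field
    _⟶_ : W → W → Set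
    len : E → ℕ
    α   : (e : E) → Fin (len e) → W
    γ   : V → Letter COL

  concrete : W → List V
  concrete = [ (λ v → v ∷ []) , (λ _ → []) ]

  colours : List V → List (Letter COL)
  colours = map γ

  col : W → List (Letter COL)
  col x = colours (concrete x)

  data Walk : W → List V → W → Set where
    edge : ∀ {u v} → u ⟶ v → Walk u [] v
    step : ∀ {u x p v} → u ⟶ inj₁ x → Walk (inj₁ x) p v → Walk u (x ∷ p) v

  Walkω : W → (ℕ → V) → Set
  Walkω u p = u ⟶ inj₁ (p 0) × (∀ i → inj₁ (p i) ⟶ inj₁ (p (suc i)))

open Skeleton

private variable
  COL   : Set
  n n′ n″ : ℕ

module _ (H : Skeleton COL n) {k : E H → ℕ} (K : ∀ e → Skeleton COL (k e)) (k≡ : ∀ e → k e ≡ len H e) where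

  private
    V[] : Set
    V[] = V H ⊎ Σ[ e ∈ E H ] V (K e)

  outˢ : W H → V[] ⊎ Fin n
  outˢ = Sum.map₁ inj₁

  innˢ : (e : E H) → W (K e) → V[] ⊎ Fin n
  innˢ e (inj₁ v) = inj₁ (inj₂ (e , v))
  innˢ e (inj₂ i) = outˢ (α H e (cast (k≡ e) i))

  data Edgeˢ : V[] ⊎ Fin n → V[] ⊎ Fin n → Set where
    outer : ∀ {u v} → _⟶_ H u v → Edgeˢ (outˢ u) (outˢ v)
    inner : ∀ e {u v} → _⟶_ (K e) u v → Edgeˢ (innˢ e u) (innˢ e v)

  replaceˢ : Skeleton COL n
  replaceˢ = record
    { V   = V[]
    ; E   = Σ[ e ∈ E H ] E (K e)
    ; _⟶_ = Edgeˢ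
    ; len = λ (e , f) → len (K e) f
    ; α   = λ (e , f) i → innˢ e (α (K e) f i)
    ; γ   = [ γ H , (λ (e , v) → γ (K e) v) ] }

skeleton : ∀ {a} {ACT COL : Set} {LAB : Set a} → HG ACT COL LAB n → Skeleton COL n
skeleton H = record
  { V = HG.V H ; E = HG.E H ; _⟶_ = HG._⟶_ H ; len = HG.len H ; α = HG.α H ; γ = HG.γ H }

module Bisimulation (em : ExcludedMiddle 0ℓ) {COL : Set} (M : Büchi COL) where
  open Words em M

  Simulates* : (H : Skeleton COL n) (H′ : Skeleton COL n′) →
               W H → List (V H) → W H → W H′ → W H′ → Set
  Simulates* H H′ x p y x′ y′ = ∃[ p′ ] Walk H′ x′ p′ y′ ×
    col H x ++ colours H p ++ col H y ≈ col H′ x′ ++ colours H′ p′ ++ col H′ y′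

  Simulatesω : (H : Skeleton COL n) (H′ : Skeleton COL n′) →
               W H → (ℕ → V H) → W H′ → Set
  Simulatesω H H′ x p x′ = ∃[ p′ ] Walkω H′ x′ p′ ×
    (col H x ++ω γ H ∘ p) ≈ω (col H′ x′ ++ω γ H′ ∘ p′)

  record TraceSim (H : Skeleton COL n) (H′ : Skeleton COL n′) (_~_ : W H → W H′ → Set) : Set where
    field
      fin : ∀ {x x′ y y′ p} → x ~ x′ → y ~ y′ → Walk H x p y → Simulates* H H′ x p y x′ y′
      inf : ∀ {x x′ p} → x ~ x′ → Walkω H x p → Simulatesω H H′ x p x′

  -- Unlike Equivalent, this relates arbitrary nodes, not only exposed ones.
  record Bisim (H : Skeleton COL n) (H′ : Skeleton COL n′) : Set₁ where
    field
      _~_     : W H → W H′ → Set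
      _~ᴱ_    : E H → E H′ → Set
      n≡      : n ≡ n′
      ~-func  : ∀ {x y y′} → x ~ y → x ~ y′ → y ≡ y′
      ~-inj   : ∀ {x x′ y} → x ~ y → x′ ~ y → x ≡ x′
      ~ᴱ-func : ∀ {e f f′} → e ~ᴱ f → e ~ᴱ f′ → f ≡ f′
      ~ᴱ-inj  : ∀ {e e′ f} → e ~ᴱ f → e′ ~ᴱ f → e ≡ e′
      total   : ∀ e → ∃[ e′ ] e ~ᴱ e′
      surj    : ∀ e′ → ∃[ e ] e ~ᴱ e′
      len≡    : ∀ {e e′} → e ~ᴱ e′ → len H e ≡ len H′ e′
      ~-abstr : ∀ i i′ → toℕ i ≡ toℕ i′ → inj₂ i ~ inj₂ i′
      ~-α     : ∀ {e e′} → e ~ᴱ e′ → ∀ i i′ → toℕ i ≡ toℕ i′ → α H e i ~ α H′ e′ i′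
      colour  : ∀ {x x′} → x ~ x′ → col H x ≈ col H′ x′
      sim     : TraceSim H H′ _~_
      sim⁻¹   : TraceSim H′ H (flip _~_)

    abstr-func : ∀ {i x′} → inj₂ i ~ x′ → ∃[ i′ ] x′ ≡ inj₂ i′ × toℕ i ≡ toℕ i′
    abstr-func {i} i~x′ = let e = sym (toℕ-cast n≡ i) in
      cast n≡ i , ~-func i~x′ (~-abstr i (cast n≡ i) e) , e

    -- `i′` is already matched to the abstract node with the same number, and `~-inj` admits no
    -- second partner.
    ¬concrete~abstr : ∀ {v i′} → ¬ inj₁ v ~ inj₂ i′
    ¬concrete~abstr {i′ = i′} v~i′
      with ~-inj v~i′ (~-abstr (cast (sym n≡) i′) i′ (toℕ-cast (sym n≡) i′))
    ... | ()

  open Bisim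
  open TraceSim

  Bisim-sym : {H : Skeleton COL n} {H′ : Skeleton COL n′} → Bisim H H′ → Bisim H′ H
  Bisim-sym B = record
    { _~_ = flip (_~_ B) ; _~ᴱ_ = flip (_~ᴱ_ B) ; n≡ = sym (n≡ B)
    ; ~-func = ~-inj B ; ~-inj = ~-func B ; ~ᴱ-func = ~ᴱ-inj B ; ~ᴱ-inj = ~ᴱ-func B
    ; total = surj B ; surj = total B ; len≡ = sym ∘ len≡ B
    ; ~-abstr = λ i i′ e → ~-abstr B i′ i (sym e) ; ~-α = λ m i i′ e → ~-α B m i′ i (sym e)
    ; colour = ≈-sym ∘ colour B ; sim = sim⁻¹ B ; sim⁻¹ = sim B }

  TraceSim-trans : {H : Skeleton COL n} {H′ : Skeleton COL n′} {H″ : Skeleton COL n″}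
                   {R : W H → W H′ → Set} {S : W H′ → W H″ → Set} {T : W H → W H″ → Set} →
                   (∀ {x z} → T x z → ∃[ y ] R x y × S y z) →
                   TraceSim H H′ R → TraceSim H′ H″ S → TraceSim H H″ T
  TraceSim-trans {H = H} {H″ = H″} {T = T} dec R S = record { fin = fin′ ; inf = inf′ }
    where
    fin′ : ∀ {x z y w p} → T x z → T y w → Walk H x p y → Simulates* H H″ x p y z w
    fin′ t t′ π with dec t | dec t′
    ... | _ , r , s | _ , r′ , s′ with fin R r r′ π
    ... | _ , π′ , e with fin S s s′ π′
    ... | p″ , π″ , e′ = p″ , π″ , ≈-trans e e′

    inf′ : ∀ {x z p} → T x z → Walkω H x p → Simulatesω H H″ x p z
    inf′ t π with dec t
    ... | _ , r , s with inf R r π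
    ... | _ , π′ , e with inf S s π′
    ... | p″ , π″ , e′ = p″ , π″ , ≈ω-trans e e′

  Bisim-trans : {H : Skeleton COL n} {H′ : Skeleton COL n′} {H″ : Skeleton COL n″} →
                Bisim H H′ → Bisim H′ H″ → Bisim H H″
  Bisim-trans {n = n} {n′ = n′} {n″ = n″} {H = H} {H′} {H″} B C = record
    { _~_ = λ x z → ∃[ y ] _~_ B x y × _~_ C y z
    ; _~ᴱ_ = λ e g → ∃[ f ] _~ᴱ_ B e f × _~ᴱ_ C f g
    ; n≡ = trans (n≡ B) (n≡ C)
    ; ~-func = λ { (_ , r , s) (_ , r′ , s′) → ~-func C s (subst (λ y → _~_ C y _) (~-func B r′ r) s′) }
    ; ~-inj = λ { (_ , r , s) (_ , r′ , s′) → ~-inj B r (subst (_~_ B _) (~-inj C s′ s) r′) }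
    ; ~ᴱ-func = λ { (_ , r , s) (_ , r′ , s′) → ~ᴱ-func C s (subst (λ y → _~ᴱ_ C y _) (~ᴱ-func B r′ r) s′) }
    ; ~ᴱ-inj = λ { (_ , r , s) (_ , r′ , s′) → ~ᴱ-inj B r (subst (_~ᴱ_ B _) (~ᴱ-inj C s′ s) r′) }
    ; total = λ e → let (f , r) = total B e ; (g , s) = total C f in g , f , r , s
    ; surj = λ g → let (f , s) = surj C g ; (e , r) = surj B f in e , f , r , s
    ; len≡ = λ { (_ , r , s) → trans (len≡ B r) (len≡ C s) }
    ; ~-abstr = λ i i″ e → let e′ = toℕ-cast (n≡ B) i in
        inj₂ (cast (n≡ B) i) , ~-abstr B i _ (sym e′) , ~-abstr C _ i″ (trans e′ e)
    ; ~-α = λ { (f , r , s) i i″ e → let e′ = toℕ-cast (len≡ B r) i in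
        α H′ f (cast (len≡ B r) i) , ~-α B r i _ (sym e′) , ~-α C s _ i″ (trans e′ e) }
    ; colour = λ { (_ , r , s) → ≈-trans (colour B r) (colour C s) }
    ; sim = TraceSim-trans id (sim B) (sim C)
    ; sim⁻¹ = TraceSim-trans (λ { (y , r , s) → y , s , r }) (sim⁻¹ C) (sim⁻¹ B) }

  Models : (H : Skeleton COL n) → W H → Set
  Models H x = ∀ p → Walkω H x p → (col H x ++ω γ H ∘ p) ∈ Büchi.Language M

  -- `Models` quantifies over all infinite paths, so each direction uses the opposite simulation: a
  -- path of the target is simulated in the source, accepted there, and acceptance returns along
  -- `≈ω`.
  Models-transfer : {H : Skeleton COL n} {H′ : Skeleton COL n′} (B : Bisim H H′) →
                    ∀ {x x′} → _~_ B x x′ → Models H x ⇔ Models H′ x′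
  Models-transfer B r = mk⇔ (half (sim⁻¹ B) r) (half (sim B) r)
    where
    half : {H : Skeleton COL n} {H′ : Skeleton COL n′} {R : W H′ → W H → Set} →
           TraceSim H′ H R → ∀ {x x′} → R x′ x → Models H x → Models H′ x′
    half S r x⊨ p′ π′ with inf S r π′
    ... | p , π , e with x⊨ p π
    ... | q₀ , q₀∈ , d = q₀ , q₀∈ , Equivalence.from (∼ω e q₀) d

  -- Joining and cutting paths, and simulation of infinite paths

  snocWalk : {H : Skeleton COL n} → ∀ {x p v q y} →
             Walk H x p (inj₁ v) → Walk H (inj₁ v) q y → Walk H x (p ++ v ∷ q) y
  snocWalk (edge e)   π′ = step e π′
  snocWalk (step e π) π′ = step e (snocWalk π π′)

  snocWalkω : {H : Skeleton COL n} → ∀ {x p v q} →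
              Walk H x p (inj₁ v) → Walkω H (inj₁ v) q → Walkω H x (p ++ω (v ∷ []) ++ω q)
  snocWalkω {H = H} (edge e)   (e₀ , es) = e , λ { zero → e₀ ; (suc i) → es i }
  snocWalkω {H = H} (step e π) π′ = let (e₀ , es) = snocWalkω {H = H} π π′ in
    e , λ { zero → e₀ ; (suc i) → es i }

  slice : {A : Set} → (ℕ → A) → ℕ → List A
  slice p zero    = []
  slice p (suc j) = p 0 ∷ slice (p ∘ suc) j

  slice-≗ : {A : Set} (p : ℕ → A) → ∀ j → p ≗ slice p j ++ω (λ i → p (i + j))
  slice-≗ p zero    i       = cong p (sym (+-identityʳ i))
  slice-≗ p (suc j) zero    = refl
  slice-≗ p (suc j) (suc i) = trans (slice-≗ (p ∘ suc) j i)
    (++ω-cong (slice (p ∘ suc) j) (λ i → cong p (sym (+-suc i j))) i)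

  takeWalk : {H : Skeleton COL n} → ∀ {x p} → Walkω H x p → ∀ j → Walk H x (slice p j) (inj₁ (p j))
  takeWalk (e , es) zero    = edge e
  takeWalk {H = H} (e , es) (suc j) = step e (takeWalk {H = H} (es 0 , es ∘ suc) j)

  dropWalk : {H : Skeleton COL n} → ∀ {x p} → Walkω H x p → ∀ j → Walkω H (inj₁ (p j)) (λ i → p (i + suc j))
  dropWalk (e , es) j = es j , λ i → es (i + suc j)

  snoc-word : {H : Skeleton COL n} (x y : List (Letter COL)) → ∀ p v q →
              x ++ colours H (p ++ v ∷ q) ++ y ≡ x ++ colours H p ++ (γ H v ∷ []) ++ colours H q ++ y
  snoc-word {H = H} x y p v q = cong (x ++_)
    (trans (cong (_++ y) (map-++ (γ H) p (v ∷ q))) (++-assoc (colours H p) (γ H v ∷ colours H q) y))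

  -- Inner nodes of an infinite path are concrete on both sides, so a cut at a concrete node needs a
  -- concrete partner; `~-concrete` provides it.
  module OmegaSim {H : Skeleton COL n} {H′ : Skeleton COL n′} (_~_ : W H → W H′ → Set)
    (~-concrete : ∀ {v x′} → inj₁ v ~ x′ → ∃[ v′ ] x′ ≡ inj₁ v′)
    (~-colour : ∀ {x x′} → x ~ x′ → col H x ≈ col H′ x′)
    (~-fin : ∀ {x x′ y y′ p} → x ~ x′ → y ~ y′ → Walk H x p y → Simulates* H H′ x p y x′ y′) where

    Cut : W H → Set
    Cut x = ∃[ x′ ] x ~ x′

    private
      prefixed : ∀ {x x′ p} → x ~ x′ → Walkω H x p → ∀ j {v′} → inj₁ (p j) ~ inj₁ v′ →
                 Simulatesω H H′ (inj₁ (p j)) (λ i → p (i + suc j)) (inj₁ v′) →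
                 Simulatesω H H′ x p x′
      prefixed {x} {x′} {p} r π j {v′} s (t′ , τ′ , te) with ~-fin r s (takeWalk {H = H} π j)
      ... | p′ , π′ , pe = p′ ++ω (v′ ∷ []) ++ω t′ , snocWalkω {H = H′} π′ τ′ ,
        ≈ω-trans (++ω-≈ (≈-refl {col H x}) (≗⇒≈ω eqˡ))
        (≈ω-trans (overlapω (col H x) (col H′ x′) (colours H (slice p j)) (colours H′ p′)
            (γ H (p j) ∷ []) (γ H′ v′ ∷ []) (~-colour s) pe te)
        (++ω-≈ (≈-refl {col H′ x′}) (≈ω-sym (≗⇒≈ω (distribute H′ p′ v′ t′)))))
        where
        distribute : ∀ {n} (H : Skeleton COL n) p v t → γ H ∘ (p ++ω (v ∷ []) ++ω t) ≗
                colours H p ++ω (γ H v ∷ []) ++ω γ H ∘ t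
        distribute H p v t i = trans (map-++ω (γ H) p ((v ∷ []) ++ω t) i)
          (++ω-cong (colours H p) (map-++ω (γ H) (v ∷ []) t) i)

        eqˡ : γ H ∘ p ≗ colours H (slice p j) ++ω (γ H (p j) ∷ []) ++ω γ H ∘ (λ i → p (i + suc j))
        eqˡ i = trans (cong (γ H) (trans (slice-≗ p j i)
            (++ω-cong (slice p j) (λ { zero → refl ; (suc i) → cong p (sym (+-suc i j)) }) i)))
          (distribute H (slice p j) (p j) (λ i → p (i + suc j)) i)

      -- Even and odd cut points are kept apart as `v` and `z`, with segments `p` from `v k` to
      -- `z k` and `q` from `z k` to `v (suc k)`, which is the shape that `overlap-≈ω` exchanges in
      -- two passes.
      module Recurrent {v z : ℕ → V H} {v′ z′ : ℕ → V H′} {p q : ℕ → List (V H)} {p′ q′ : ℕ → List (V H′)}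
        {rest : ℕ → ℕ → V H}
        (rest≗ : ∀ k → (v k ∷ []) ++ω rest k ≗ (v k ∷ p k) ++ω (z k ∷ q k) ++ω (v (suc k) ∷ []) ++ω rest (suc k))
        (v~v′ : ∀ k → inj₁ (v k) ~ inj₁ (v′ k)) (z~z′ : ∀ k → inj₁ (z k) ~ inj₁ (z′ k))
        (p-path : ∀ k → Walk H′ (inj₁ (v′ k)) (p′ k) (inj₁ (z′ k)))
        (q-path : ∀ k → Walk H′ (inj₁ (z′ k)) (q′ k) (inj₁ (v′ (suc k))))
        (p≈ : ∀ k → γ H (v k) ∷ colours H (p k) ++ γ H (z k) ∷ [] ≈
                    γ H′ (v′ k) ∷ colours H′ (p′ k) ++ γ H′ (z′ k) ∷ [])
        (q≈ : ∀ k → γ H (z k) ∷ colours H (q k) ++ γ H (v (suc k)) ∷ [] ≈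
                    γ H′ (z′ k) ∷ colours H′ (q′ k) ++ γ H′ (v′ (suc k)) ∷ []) where

        block : ℕ → List (V H′)
        block k = p′ k ++ z′ k ∷ q′ k

        block-path : ∀ k → Walk H′ (inj₁ (v′ k)) (block k) (inj₁ (v′ (suc k)))
        block-path k = snocWalk (p-path k) (q-path k)

        C : ℕ → ℕ → V H′
        C = concat v′ block

        advance : ∀ i {u q k} → Walk H′ (inj₁ u) q (inj₁ (v′ k)) →
                  _⟶_ H′ (inj₁ (((u ∷ q) ++ω C k) i)) (inj₁ (((u ∷ q) ++ω C k) (suc i)))
        advance zero    (edge e)   = e
        advance zero    (step e _) = e
        advance (suc i) {k = k} (edge _)
          rewrite concat-unfold v′ block k i
                | concat-unfold v′ block k (suc i) = advance i (block-path k)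
        advance (suc i) (step _ π) = advance i π

        C-path : ∀ i → _⟶_ H′ (inj₁ (C 0 i)) (inj₁ (C 0 (suc i)))
        C-path i rewrite concat-unfold v′ block 0 i
                       | concat-unfold v′ block 0 (suc i) = advance i (block-path 0)

        ω : ℕ → ℕ → Letter COL
        ω k = γ H ∘ ((v k ∷ []) ++ω rest k)

        ω≗ : IsConcat (γ H ∘ v) (λ k → colours H (p k) ++ γ H (z k) ∷ colours H (q k)) ω
        ω≗ k i = trans (cong (γ H) (trans (rest≗ k i)
              (sym (++ω-assoc (v k ∷ p k) (z k ∷ q k) ((v (suc k) ∷ []) ++ω rest (suc k)) i))))
          (trans (map-++ω (γ H) (v k ∷ p k ++ z k ∷ q k) ((v (suc k) ∷ []) ++ω rest (suc k)) i)
            (cong (λ w → ((γ H (v k) ∷ w) ++ω ω (suc k)) i) (map-++ (γ H) (p k) (z k ∷ q k))))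

        ω′≗ : IsConcat (γ H′ ∘ v′) (λ k → colours H′ (p′ k) ++ γ H′ (z′ k) ∷ colours H′ (q′ k)) (λ k → γ H′ ∘ C k)
        ω′≗ k i = trans (cong (γ H′) (concat-unfold v′ block k i))
          (trans (map-++ω (γ H′) (v′ k ∷ block k) (C (suc k)) i)
            (cong (λ w → ((γ H′ (v′ k) ∷ w) ++ω γ H′ ∘ C (suc k)) i) (map-++ (γ H′) (p′ k) (z′ k ∷ q′ k))))

        recurrent : Simulatesω H H′ (inj₁ (v 0)) (rest 0) (inj₁ (v′ 0))
        recurrent = C 0 ∘ suc , (C-path 0 , C-path ∘ suc) ,
          ≈ω-trans (≗⇒≈ω (λ { zero → refl ; (suc i) → refl }))
          (≈ω-trans (overlap-≈ω ω≗ ω′≗ (λ k → ~-colour (v~v′ k)) (λ k → ~-colour (z~z′ k)) p≈ q≈)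
          (≗⇒≈ω (λ { zero → refl ; (suc i) → refl })))

      record State : Set where
        field
          {v}    : V H
          {v′}   : V H′
          {rest} : ℕ → V H
          v~v′   : inj₁ v ~ inj₁ v′
          path   : Walkω H (inj₁ v) rest
          often  : InfinitelyOften (λ j → Cut (inj₁ (rest j)))

      record Step (s : State) : Set where
        open State s
        field
          next      : State
          {segment} : List (V H)
          rest≗     : (v ∷ []) ++ω rest ≗ (v ∷ segment) ++ω (State.v next ∷ []) ++ω State.rest next
          simulated : Simulates* H H′ (inj₁ v) segment (inj₁ (State.v next)) (inj₁ v′) (inj₁ (State.v′ next))

      advance : ∀ s → Step s
      advance s with State.often s 0
      ... | j , _ , _ , r with ~-concrete r
      ... | _ , refl = record
        { next = record { v~v′ = r ; path = dropWalk {H = H} (State.path s) j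
                        ; often = often-drop (State.often s) (suc j) }
        ; rest≗ = λ { zero → refl ; (suc i) → trans (slice-≗ rest j i)
            (++ω-cong (slice rest j) (λ { zero → refl ; (suc i) → cong rest (sym (+-suc i j)) }) i) }
        ; simulated = ~-fin (State.v~v′ s) r (takeWalk {H = H} (State.path s) j) }
        where open State s using (rest)

      recurrent : (s : State) → Simulatesω H H′ (inj₁ (State.v s)) (State.rest s) (inj₁ (State.v′ s))
      recurrent s₀ = Recurrent.recurrent
        (λ k i → trans (Step.rest≗ (advance (st k)) i)
          (++ω-cong (State.v (st k) ∷ Step.segment (advance (st k))) (Step.rest≗ (advance (mid k))) i))
        (State.v~v′ ∘ st) (State.v~v′ ∘ mid)
        (λ k → proj₁ (proj₂ (Step.simulated (advance (st k)))))
        (λ k → proj₁ (proj₂ (Step.simulated (advance (mid k)))))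
        (λ k → proj₂ (proj₂ (Step.simulated (advance (st k)))))
        (λ k → proj₂ (proj₂ (Step.simulated (advance (mid k)))))
        where
        st mid : ℕ → State
        st zero    = s₀
        st (suc k) = Step.next (advance (mid k))
        mid k = Step.next (advance (st k))

    -- An infinite path either returns to related nodes forever, or it has a last
    -- related node, after which only an uncut path has to be simulated.
    ~-inf : (∀ {x x′ p} → x ~ x′ → Walkω H x p → (∀ j → ¬ Cut (inj₁ (p j))) → Simulatesω H H′ x p x′) →
            ∀ {x x′ p} → x ~ x′ → Walkω H x p → Simulatesω H H′ x p x′
    ~-inf uncut {x} {x′} {p} r π with em {InfinitelyOften (λ j → Cut (inj₁ (p j)))}
    ... | yes often with often 0
    ...   | j , _ , _ , s with ~-concrete s
    ...   | _ , refl = prefixed r π j s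
      (recurrent (record { v~v′ = s ; path = dropWalk {H = H} π j ; often = often-drop often (suc j) }))
    ~-inf uncut {x} {x′} {p} r π | no ¬often with em-¬∀ ¬often
    ...   | N , late = search N (λ j N≤j cut → late (j , N≤j , cut))
      where
      -- Descends from a bound past which no node is related, so the first related node met is the
      -- last one on the path. If none is met, the path is uncut from its start.
      search : ∀ N → (∀ j → N ≤ j → ¬ Cut (inj₁ (p j))) → Simulatesω H H′ x p x′
      search zero    late = uncut r π (λ j → late j z≤n)
      search (suc N) late with em {Cut (inj₁ (p N))}
      ... | no ¬cut = search N late′
        where
        late′ : ∀ j → N ≤ j → ¬ Cut (inj₁ (p j))
        late′ j N≤j with m≤n⇒m<n∨m≡n N≤j
        ... | inj₁ N<j  = late j N<j
        ... | inj₂ refl = ¬cut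
      ... | yes (_ , s) with ~-concrete s
      ... | _ , refl = prefixed r π N s
        (uncut s (dropWalk {H = H} π N) (λ j → late (j + suc N) (m≤n+m (suc N) j)))

  -- Traces and 𝓜-equivalence of hypergraphs in terms of bisimilarity

  module _ {a} {ACT : Set} {LAB : Set a} (H : HG ACT COL LAB n) where

    private
      S : Skeleton COL n
      S = skeleton H

    fromPath : ∀ {x p y} → Path H x p y → Walk S x p y
    fromPath (edge e)   = edge e
    fromPath (step e π) = step e (fromPath π)

    toPath : ∀ {x p y} → Walk S x p y → Path H x p y
    toPath (edge e)   = edge e
    toPath (step e π) = step e (toPath π)

    trace-word : ∀ x p y → map (γ S) (concrete S x ++ p ++ concrete S y) ≡ col S x ++ colours S p ++ col S y
    trace-word x p y = trans (map-++ (γ S) (concrete S x) (p ++ concrete S y))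
      (cong (col S x ++_) (map-++ (γ S) p (concrete S y)))

    trace-wordω : ∀ x p → γ S ∘ concreteω H x p ≗ col S x ++ω γ S ∘ p
    trace-wordω (inj₁ v) p zero    = refl
    trace-wordω (inj₁ v) p (suc i) = refl
    trace-wordω (inj₂ _) p i       = refl

    ⊨⇔Models : ∀ x → _⊨_ H x M ⇔ Models S x
    ⊨⇔Models x = mk⇔
      (λ x⊨ p π → x⊨ (col S x ++ω γ S ∘ p) (p , π , sym ∘ trace-wordω x p))
      (λ x⊨ σ (p , π , σ≗) → let (q₀ , q₀∈ , d) = x⊨ p π in
        q₀ , q₀∈ , Equivalence.from (∼ω (≗⇒≈ω (λ i → trans (σ≗ i) (trace-wordω x p i))) q₀) d)

  module _ {a b} {ACT : Set} {LAB : Set a} {LAB′ : Set b}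
           {H : HG ACT COL LAB n} {H′ : HG ACT COL LAB′ n′} where

    traces⇒fin : ∀ x y x′ y′ → (∀ σ → σ ∈ Traces* H x y → ∃[ σ′ ] σ′ ∈ Traces* H′ x′ y′ × σ ≈ σ′) →
                 ∀ {p} → Walk (skeleton H) x p y → Simulates* (skeleton H) (skeleton H′) x p y x′ y′
    traces⇒fin x y x′ y′ f {p} π with f _ (p , toPath H π , refl)
    ... | _ , (p′ , π′ , refl) , e = p′ , fromPath H′ π′ , ≈-trans (≈-reflexive (sym (trace-word H x p y)))
      (≈-trans e (≈-reflexive (trace-word H′ x′ p′ y′)))

    traces⇒inf : ∀ x x′ → (∀ σ → σ ∈ Tracesω H x → ∃[ σ′ ] σ′ ∈ Tracesω H′ x′ × σ ≈ω σ′) →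
                 ∀ {p} → Walkω (skeleton H) x p → Simulatesω (skeleton H) (skeleton H′) x p x′
    traces⇒inf x x′ f {p} π with f _ (p , π , λ _ → refl)
    ... | _ , (p′ , π′ , e≗) , e = p′ , π′ , ≈ω-trans (≈ω-sym (≗⇒≈ω (trace-wordω H x p)))
      (≈ω-trans e (≗⇒≈ω (λ i → trans (e≗ i) (trace-wordω H′ x′ p′ i))))

  module _ {a b} {ACT : Set} {LAB : Set a} {LAB′ : Set b}
           {H : HG ACT COL LAB n} {H′ : HG ACT COL LAB′ n′} where

    fromEquivalent : Equivalent M H H′ → Bisim (skeleton H) (skeleton H′)
    fromEquivalent eq = record
      { _~_ = _~₀_ ; _~ᴱ_ = λ e e′ → onE e ≡ e′
      ; n≡ = n≡₀
      ; ~-func = λ { (_ , refl) (_ , refl) → Inverse.to-cong ν refl }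
      ; ~-inj = λ { (_ , e) (_ , e′) → onX-injective (trans e (sym e′)) }
      ; ~ᴱ-func = λ { refl refl → refl }
      ; ~ᴱ-inj = λ { {e} {e′} refl m → trans (sym (Inverse.strictlyInverseʳ μ e))
                       (trans (cong (Inverse.from μ) (sym m)) (Inverse.strictlyInverseʳ μ e′)) }
      ; total = λ e → onE e , refl
      ; surj = λ e′ → Inverse.from μ e′ , Inverse.strictlyInverseˡ μ e′
      ; len≡ = λ { {e} refl → len≡₀ e }
      ; ~-abstr = λ i i′ e → abstr i , trans (ν-abstr i) (cong inj₂ (toℕ-injective (trans (toℕ-cast n≡₀ i) e)))
      ; ~-α = λ { {e} refl i i′ eq → attached e i , trans (ν-attached e i)
                    (cong (HG.α H′ (onE e)) (toℕ-injective (trans (toℕ-cast (len≡₀ e) i) eq))) }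
      ; colour = λ { {x} (ex , refl) → ∼*⇒≈ (colour₀ (x , ex)) }
      ; sim = record
        { fin = λ { {x} {y = y} (ex , refl) (ey , refl) → traces⇒fin x y (onX (x , ex)) (onX (y , ey)) λ σ σ∈ →
            let (σ′ , σ′∈ , σ∼σ′) = proj₁ (traces* (x , ex) (y , ey)) σ σ∈ in σ′ , σ′∈ , ∼*⇒≈ σ∼σ′ }
        ; inf = λ { {x} (ex , refl) → traces⇒inf x (onX (x , ex)) λ σ σ∈ →
            let (σ′ , σ′∈ , σ∼σ′) = proj₁ (tracesω (x , ex)) σ σ∈ in σ′ , σ′∈ , mk≈ω σ∼σ′ } }
      ; sim⁻¹ = record
        { fin = λ { {_} {x} {_} {y} (ex , refl) (ey , refl) → traces⇒fin (onX (x , ex)) (onX (y , ey)) x y λ σ′ σ′∈ →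
            let (σ , σ∈ , σ∼σ′) = proj₂ (traces* (x , ex) (y , ey)) σ′ σ′∈ in σ , σ∈ , ≈-sym (∼*⇒≈ σ∼σ′) }
        ; inf = λ { {_} {x} (ex , refl) → traces⇒inf (onX (x , ex)) x λ σ′ σ′∈ →
            let (σ , σ∈ , σ∼σ′) = proj₂ (tracesω (x , ex)) σ′ σ′∈ in σ , σ∈ , ≈ω-sym (mk≈ω σ∼σ′) } } }
      where
      open Equivalent eq renaming (n≡ to n≡₀; len≡ to len≡₀; colour to colour₀)

      -- A node can be exposed in several ways. `𝕏` compares the nodes only, so `onX` does not
      -- depend on the exposure proof and the relation is functional.
      _~₀_ : W (skeleton H) → W (skeleton H′) → Set
      x ~₀ x′ = Σ[ ex ∈ Exposed H x ] onX (x , ex) ≡ x′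

      onX-injective : ∀ {x y} → onX x ≡ onX y → proj₁ x ≡ proj₁ y
      onX-injective {x} {y} e = trans (sym (Inverse.strictlyInverseʳ ν x))
        (trans (Inverse.from-cong ν e) (Inverse.strictlyInverseʳ ν y))

  -- Isomorphic skeletons are bisimilar

  record Iso (H : Skeleton COL n) (H′ : Skeleton COL n) : Set where
    field
      V↔     : V H ↔ V H′
      E↔     : E H ↔ E H′
      len≡   : ∀ e → len H e ≡ len H′ (Inverse.to E↔ e)
      α≡     : ∀ e i i′ → toℕ i ≡ toℕ i′ →
               Sum.map₁ (Inverse.to V↔) (α H e i) ≡ α H′ (Inverse.to E↔ e) i′
      edges  : ∀ {x y} → _⟶_ H x y →
               _⟶_ H′ (Sum.map₁ (Inverse.to V↔) x) (Sum.map₁ (Inverse.to V↔) y)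
      edges⁻ : ∀ {x y} → _⟶_ H′ x y →
               _⟶_ H (Sum.map₁ (Inverse.from V↔) x) (Sum.map₁ (Inverse.from V↔) y)
      γ≗     : ∀ v → γ H v ≗ γ H′ (Inverse.to V↔ v)

  TraceSim-map : {H : Skeleton COL n} {H′ : Skeleton COL n} (f : V H → V H′) →
                 (∀ {x y} → _⟶_ H x y → _⟶_ H′ (Sum.map₁ f x) (Sum.map₁ f y)) →
                 (∀ v → γ H v ≗ γ H′ (f v)) →
                 {R : W H → W H′ → Set} → (∀ {x x′} → R x x′ → Sum.map₁ f x ≡ x′) →
                 TraceSim H H′ R
  TraceSim-map {H = H} {H′} f f-edge f-γ graph = record
    { fin = λ r r′ π → fin′ (graph r) (graph r′) π
    ; inf = λ r π → inf′ (graph r) π }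
    where
    f-path : ∀ {x p y} → Walk H x p y → Walk H′ (Sum.map₁ f x) (map f p) (Sum.map₁ f y)
    f-path (edge e)   = edge (f-edge e)
    f-path (step e π) = step (f-edge e) (f-path π)

    f-colours : ∀ p → colours H p ≈ colours H′ (map f p)
    f-colours p = ≈-trans (letterwise f-γ p) (≈-reflexive (map-∘ p))

    f-col : ∀ x → col H x ≈ col H′ (Sum.map₁ f x)
    f-col (inj₁ v) = f-colours (v ∷ [])
    f-col (inj₂ i) = ≈-refl

    fin′ : ∀ {x x′ y y′ p} → Sum.map₁ f x ≡ x′ → Sum.map₁ f y ≡ y′ → Walk H x p y → Simulates* H H′ x p y x′ y′
    fin′ {x} {y = y} {p = p} refl refl π =
      map f p , f-path π , ++-cong (f-col x) (++-cong (f-colours p) (f-col y))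

    inf′ : ∀ {x x′ p} → Sum.map₁ f x ≡ x′ → Walkω H x p → Simulatesω H H′ x p x′
    inf′ {x} {p = p} refl (e , es) = f ∘ p , (f-edge e , λ i → f-edge (es i)) ,
      ++ω-≈ (f-col x) (pointwise⇒≈ω (f-γ ∘ p))

  fromIso : {H : Skeleton COL n} {H′ : Skeleton COL n} → Iso H H′ → Bisim H H′
  fromIso {H = H} {H′} I = record
    { _~_ = λ x x′ → Sum.map₁ to x ≡ x′ ; _~ᴱ_ = λ e e′ → Inverse.to E↔ e ≡ e′
    ; n≡ = refl
    ; ~-func = λ { refl refl → refl }
    ; ~-inj = λ { {x} {x′} r r′ → trans (sym (graph⁻ r)) (graph⁻ r′) }
    ; ~ᴱ-func = λ { refl refl → refl }
    ; ~ᴱ-inj = λ { {e} {e′} refl m → trans (sym (Inverse.strictlyInverseʳ E↔ e))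
                     (trans (cong (Inverse.from E↔) (sym m)) (Inverse.strictlyInverseʳ E↔ e′)) }
    ; total = λ e → Inverse.to E↔ e , refl
    ; surj = λ e′ → Inverse.from E↔ e′ , Inverse.strictlyInverseˡ E↔ e′
    ; len≡ = λ { {e} refl → len≡₀ e }
    ; ~-abstr = λ i i′ e → cong inj₂ (toℕ-injective e)
    ; ~-α = λ { {e} refl i i′ eq → α≡ e i i′ eq }
    ; colour = λ { {inj₁ v} refl → letterwise (λ { tt → γ≗ v }) (tt ∷ []) ; {inj₂ _} refl → ≈-refl }
    ; sim = TraceSim-map to edges γ≗ id
    ; sim⁻¹ = TraceSim-map from edges⁻
        (λ v c → trans (cong (λ v → γ H′ v c) (sym (Inverse.strictlyInverseˡ V↔ v))) (sym (γ≗ (from v) c)))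
        graph⁻ }
    where
    open Iso I renaming (len≡ to len≡₀)
    to   = Inverse.to V↔
    from = Inverse.from V↔

    graph⁻ : ∀ {x x′} → Sum.map₁ to x ≡ x′ → Sum.map₁ from x′ ≡ x
    graph⁻ {inj₁ v} refl = cong inj₁ (Inverse.strictlyInverseʳ V↔ v)
    graph⁻ {inj₂ _} refl = refl

  Bisim-refl : {H : Skeleton COL n} → Bisim H H
  Bisim-refl {H = H} = fromIso (record
    { V↔ = ↔-refl ; E↔ = ↔-refl ; len≡ = λ _ → refl
    ; α≡ = λ e i i′ eq → trans (map₁-id _) (cong (α H e) (toℕ-injective eq))
    ; edges = λ {x} {y} → subst₂ (_⟶_ H) (sym (map₁-id x)) (sym (map₁-id y))
    ; edges⁻ = λ {x} {y} → subst₂ (_⟶_ H) (sym (map₁-id x)) (sym (map₁-id y))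
    ; γ≗ = λ _ _ → refl })

  -- Bisimilarity is a congruence for replacement

  module ReplacePaths (H : Skeleton COL n) {k : E H → ℕ} (K : ∀ e → Skeleton COL (k e))
    (k≡ : ∀ e → k e ≡ len H e) where

    G : Skeleton COL n
    G = replaceˢ H K k≡

    out : W H → W G
    out = outˢ H K k≡

    inn : ∀ e → W (K e) → W G
    inn = innˢ H K k≡

    -- The colours that a node of K e adopts in H[K] in addition to its own: none,
    -- unless it is abstract and is identified with a concrete node of H.
    ext : ∀ e → W (K e) → List (Letter COL)
    ext e (inj₁ _) = []
    ext e (inj₂ i) = col H (α H e (cast (k≡ e) i))

    col-outer : ∀ u → col G (out u) ≡ col H u
    col-outer (inj₁ _) = refl
    col-outer (inj₂ _) = refl

    col-innerˡ : ∀ e u → col G (inn e u) ≡ ext e u ++ col (K e) u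
    col-innerˡ e (inj₁ _) = refl
    col-innerˡ e (inj₂ i) = trans (col-outer (α H e (cast (k≡ e) i))) (sym (++-identityʳ _))

    col-innerʳ : ∀ e u → col G (inn e u) ≡ col (K e) u ++ ext e u
    col-innerʳ e (inj₁ _) = refl
    col-innerʳ e (inj₂ i) = col-outer (α H e (cast (k≡ e) i))

    outer-path : ∀ {u p v} → Walk H u p v → Walk G (out u) (map inj₁ p) (out v)
    outer-path (edge h)   = edge (outer h)
    outer-path (step h π) = step (outer h) (outer-path π)

    inner-path : ∀ {e u p v} → Walk (K e) u p v → Walk G (inn e u) (map (λ w → inj₂ (e , w)) p) (inn e v)
    inner-path (edge h)   = edge (inner _ h)
    inner-path (step h π) = step (inner _ h) (inner-path π)

    outer-word : ∀ u p v → col G (out u) ++ colours G (map inj₁ p) ++ col G (out v) ≡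
                           col H u ++ colours H p ++ col H v
    outer-word u p v = cong₂ _++_ (col-outer u) (cong₂ _++_ (sym (map-∘ p)) (col-outer v))

    -- At each endpoint either the own colour word or `ext` is empty, so their order is free.
    -- Placing `ext` on the outside leaves the word of `K e` contiguous and thus exchangeable.
    inner-word : ∀ e u p v → col G (inn e u) ++ colours G (map (λ w → inj₂ (e , w)) p) ++ col G (inn e v) ≡
                             ext e u ++ (col (K e) u ++ colours (K e) p ++ col (K e) v) ++ ext e v
    inner-word e u p v = trans
      (cong₂ _++_ (col-innerˡ e u) (cong₂ _++_ (sym (map-∘ p)) (col-innerʳ e v)))
      (trans (++-assoc (ext e u) (col (K e) u) _)
        (cong (ext e u ++_) (trans (cong (col (K e) u ++_) (sym (++-assoc (colours (K e) p) (col (K e) v) (ext e v))))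
          (sym (++-assoc (col (K e) u) (colours (K e) p ++ col (K e) v) (ext e v))))))

    outer-wordω : ∀ u q → col G (out u) ++ω γ H ∘ q ≗ col H u ++ω γ H ∘ q
    outer-wordω u q i = cong (λ w → (w ++ω γ H ∘ q) i) (col-outer u)

    inner-wordω : ∀ e u q → col G (inn e u) ++ω γ (K e) ∘ q ≗ ext e u ++ω col (K e) u ++ω γ (K e) ∘ q
    inner-wordω e u q i = trans (cong (λ w → (w ++ω γ (K e) ∘ q) i) (col-innerˡ e u))
      (++ω-assoc (ext e u) (col (K e) u) (γ (K e) ∘ q) i)

  module Replacement
    {H : Skeleton COL n} {H′ : Skeleton COL n′} (B : Bisim H H′)
    {k : E H → ℕ} {K : ∀ e → Skeleton COL (k e)} (k≡ : ∀ e → k e ≡ len H e)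
    {k′ : E H′ → ℕ} {K′ : ∀ e → Skeleton COL (k′ e)} (k′≡ : ∀ e → k′ e ≡ len H′ e)
    (Bᴷ₀ : ∀ {e e′} → _~ᴱ_ B e e′ → Bisim (K e) (K′ e′)) where

    private
      open module L = ReplacePaths H K k≡
      open module L′ = ReplacePaths H′ K′ k′≡ using () renaming (G to G′; out to out′; inn to inn′)

    -- The bisimulation between K e and K′ e′ must not depend on the proof that
    -- e and e′ are related, so one such proof is singled out.
    Bᴷ : ∀ {e e′} → _~ᴱ_ B e e′ → Bisim (K e) (K′ e′)
    Bᴷ m = Bᴷ₀ (canonical m)

    Bᴷ-const : ∀ {e e′} (m m′ : _~ᴱ_ B e e′) → Bᴷ m ≡ Bᴷ m′
    Bᴷ-const m m′ = cong Bᴷ₀ (canonical-const m m′)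

    -- An abstract node of `K e` is identified with a node of `H`, so it gets no constructor of its
    -- own; `≈ᴳ-inner` reduces it to `≈ᴳ-outer`.
    data _≈ᴳ_ : W G → W G′ → Set where
      outerᵛ : ∀ {v v′} → _~_ B (inj₁ v) (inj₁ v′) → inj₁ (inj₁ v) ≈ᴳ inj₁ (inj₁ v′)
      outerⁱ : ∀ {i i′} → _~_ B (inj₂ i) (inj₂ i′) → inj₂ i ≈ᴳ inj₂ i′
      innerᵛ : ∀ {e e′ v v′} (m : _~ᴱ_ B e e′) → _~_ (Bᴷ m) (inj₁ v) (inj₁ v′) →
               inj₁ (inj₂ (e , v)) ≈ᴳ inj₁ (inj₂ (e′ , v′))

    ≈ᴳ-outer : ∀ {u u′} → _~_ B u u′ → out u ≈ᴳ out′ u′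
    ≈ᴳ-outer {inj₁ _} {inj₁ _} r = outerᵛ r
    ≈ᴳ-outer {inj₂ _} {inj₂ _} r = outerⁱ r
    ≈ᴳ-outer {inj₁ _} {inj₂ _} r = ⊥-elim (¬concrete~abstr B r)
    ≈ᴳ-outer {inj₂ _} {inj₁ _} r = ⊥-elim (¬concrete~abstr (Bisim-sym B) r)

    α~ : ∀ {e e′} → _~ᴱ_ B e e′ → ∀ i i′ → toℕ i ≡ toℕ i′ →
         _~_ B (α H e (cast (k≡ e) i)) (α H′ e′ (cast (k′≡ e′) i′))
    α~ {e} {e′} m i i′ eq = ~-α B m _ _ (trans (toℕ-cast (k≡ e) i) (trans eq (sym (toℕ-cast (k′≡ e′) i′))))

    ≈ᴳ-inner : ∀ {e e′ u u′} (m : _~ᴱ_ B e e′) → _~_ (Bᴷ m) u u′ → inn e u ≈ᴳ inn′ e′ u′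
    ≈ᴳ-inner {u = inj₁ _} {inj₁ _} m r = innerᵛ m r
    ≈ᴳ-inner {u = inj₁ _} {inj₂ _} m r = ⊥-elim (¬concrete~abstr (Bᴷ m) r)
    ≈ᴳ-inner {u = inj₂ i} m r with abstr-func (Bᴷ m) r
    ... | i′ , refl , eq = ≈ᴳ-outer (α~ m i i′ eq)

    ≈ᴳ-outer⁻ : ∀ {u x′} → out u ≈ᴳ x′ → ∃[ u′ ] x′ ≡ out′ u′ × _~_ B u u′
    ≈ᴳ-outer⁻ {inj₁ _} (outerᵛ r) = _ , refl , r
    ≈ᴳ-outer⁻ {inj₂ _} (outerⁱ r) = _ , refl , r

    -- For abstract `u` the node in question is an attached node of `H`; by `~-func` its only
    -- partner is the node attached to `e′` at the same place.
    ≈ᴳ-inner⁻ : ∀ {e e′ u x′} (m : _~ᴱ_ B e e′) → inn e u ≈ᴳ x′ →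
                ∃[ u′ ] x′ ≡ inn′ e′ u′ × _~_ (Bᴷ m) u u′
    ≈ᴳ-inner⁻ {u = inj₁ v} m (innerᵛ m′ r) with ~ᴱ-func B m m′
    ... | refl = _ , refl , subst (λ B → _~_ B (inj₁ v) _) (Bᴷ-const m′ m) r
    ≈ᴳ-inner⁻ {e} {e′} {inj₂ i} m s with ≈ᴳ-outer⁻ {α H e (cast (k≡ e) i)} s
    ... | _ , refl , r = inj₂ i′ , cong out′ (~-func B r (α~ m i i′ eq)) , ~-abstr (Bᴷ m) i i′ eq
      where
      i′ = cast (n≡ (Bᴷ m)) i
      eq = sym (toℕ-cast (n≡ (Bᴷ m)) i)

    ≈ᴳ-concrete : ∀ {v x′} → inj₁ v ≈ᴳ x′ → ∃[ v′ ] x′ ≡ inj₁ v′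
    ≈ᴳ-concrete (outerᵛ _)   = _ , refl
    ≈ᴳ-concrete (innerᵛ _ _) = _ , refl

    ≈ᴳ-colour : ∀ {x x′} → x ≈ᴳ x′ → col G x ≈ col G′ x′
    ≈ᴳ-colour (outerᵛ r)   = colour B r
    ≈ᴳ-colour (outerⁱ r)   = ≈-refl
    ≈ᴳ-colour (innerᵛ m r) = colour (Bᴷ m) r

    ≈ᴳ-func : ∀ {x y y′} → x ≈ᴳ y → x ≈ᴳ y′ → y ≡ y′
    ≈ᴳ-func (outerᵛ r) (outerᵛ r′) with ~-func B r r′
    ... | refl = refl
    ≈ᴳ-func (outerⁱ r) (outerⁱ r′) with ~-func B r r′
    ... | refl = refl
    ≈ᴳ-func (innerᵛ {v = v} m r) (innerᵛ m′ r′) with ~ᴱ-func B m m′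
    ... | refl with ~-func (Bᴷ m) r (subst (λ B → _~_ B (inj₁ v) _) (Bᴷ-const m′ m) r′)
    ... | refl = refl

    _≈ᴱ_ : E G → E G′ → Set
    (e , f) ≈ᴱ (e′ , f′) = Σ[ m ∈ _~ᴱ_ B e e′ ] _~ᴱ_ (Bᴷ m) f f′

    ≈ᴱ-func : ∀ {x y y′} → x ≈ᴱ y → x ≈ᴱ y′ → y ≡ y′
    ≈ᴱ-func {e , f} (m , r) (m′ , r′) with ~ᴱ-func B m m′
    ... | refl with ~ᴱ-func (Bᴷ m) r (subst (λ B → _~ᴱ_ B f _) (Bᴷ-const m′ m) r′)
    ... | refl = refl

    ≈ᴱ-total : ∀ x → ∃[ x′ ] x ≈ᴱ x′
    ≈ᴱ-total (e , f) with total B e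
    ... | e′ , m with total (Bᴷ m) f
    ... | f′ , m′ = (e′ , f′) , m , m′

    -- Cutting the paths of a replacement

    private
      Cut : W G → Set
      Cut x = ∃[ x′ ] x ≈ᴳ x′

      -- Components share only attached nodes, so a path can change component nowhere else. That
      -- these nodes are always matched is what makes cutting possible.
      cut-α : ∀ e i → Cut (out (α H e i))
      cut-α e i with total B e
      ... | e′ , m = _ , ≈ᴳ-outer (~-α B m i (cast (len≡ B m) i) (sym (toℕ-cast (len≡ B m) i)))

      -- `out u` and `inn e u` are not constructor forms, so unification gets stuck on them in an
      -- index; the endpoints are given by equations instead.
      data EdgeView (x y : W G) : Set where
        outerE : ∀ {u v} → _⟶_ H u v → x ≡ out u → y ≡ out v → EdgeView x y
        innerE : ∀ {e u v} → _⟶_ (K e) u v → x ≡ inn e u → y ≡ inn e v → EdgeView x y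

      edgeView : ∀ {x y} → _⟶_ G x y → EdgeView x y
      edgeView (outer h)   = outerE h refl refl
      edgeView (inner e h) = innerE h refl refl

      data Piece (x : W G) (p : List (V G)) (y : W G) : Set where
        outerP : ∀ {u q v} → Walk H u q v → x ≡ out u → p ≡ map inj₁ q → y ≡ out v → Piece x p y
        innerP : ∀ {e u q v} → Walk (K e) u q v → x ≡ inn e u → p ≡ map (λ w → inj₂ (e , w)) q →
                 y ≡ inn e v → Piece x p y

      data Pieces : W G → List (V G) → W G → Set where
        [_]  : ∀ {x p y} → Piece x p y → Pieces x p y
        _∣_∷_ : ∀ {x p v q y} → Piece x p (inj₁ v) → Cut (inj₁ v) → Pieces (inj₁ v) q y →
                Pieces x (p ++ v ∷ q) y

      -- If `v` is a concrete node of a component on both sides, edge and piece lie in the same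
      -- component and merge. Otherwise `v` is an attached node and becomes a cut.
      extend : ∀ {x v p y} → _⟶_ G x (inj₁ v) → Piece (inj₁ v) p y →
               Piece x (v ∷ p) y ⊎ (Piece x [] (inj₁ v) × Cut (inj₁ v))
      extend e P with edgeView e
      extend _ (outerP {inj₁ _} π refl refl ey) | outerE {v = inj₁ _} h ex refl =
        inj₁ (outerP (step h π) ex refl ey)
      extend _ (innerP {e} {inj₂ i} π eu refl ey) | outerE {v = inj₁ w} h ex refl =
        inj₂ (outerP (edge h) ex refl refl , subst Cut (sym eu) (cut-α e _))
      extend _ (innerP {u = inj₁ _} π refl refl ey) | innerE {v = inj₁ _} h ex refl =
        inj₁ (innerP (step h π) ex refl ey)
      extend _ (outerP {inj₁ _} π () refl ey) | innerE {v = inj₁ _} h ex refl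
      extend _ (innerP {e} {inj₂ i} π eu refl ey) | innerE {v = inj₁ _} h ex refl =
        inj₂ (innerP (edge h) ex refl refl , subst Cut (sym eu) (cut-α e _))
      extend _ P | innerE {e} {v = inj₂ i} h ex ey =
        inj₂ (innerP (edge h) ex refl ey , subst Cut (sym ey) (cut-α e _))

      pieces : ∀ {x p y} → Walk G x p y → Pieces x p y
      pieces (edge e) with edgeView e
      ... | outerE h ex ey = [ outerP (edge h) ex refl ey ]
      ... | innerE h ex ey = [ innerP (edge h) ex refl ey ]
      pieces (step e π) with pieces π
      ... | [ P ] with extend e P
      ...   | inj₁ P′      = [ P′ ]
      ...   | inj₂ (P′ , c) = P′ ∣ c ∷ [ P ]
      pieces (step e π) | P ∣ c ∷ Ps with extend e P
      ...   | inj₁ P′       = P′ ∣ c ∷ Ps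
      ...   | inj₂ (P′ , c′) = P′ ∣ c′ ∷ (P ∣ c ∷ Ps)

    private
      ext-≈ : ∀ {e e′ u u′} (m : _~ᴱ_ B e e′) → _~_ (Bᴷ m) u u′ → ext e u ≈ L′.ext e′ u′
      ext-≈ {u = inj₁ _} {inj₁ _} m r = ≈-refl
      ext-≈ {u = inj₁ _} {inj₂ _} m r = ⊥-elim (¬concrete~abstr (Bᴷ m) r)
      ext-≈ {u = inj₂ i} m r with abstr-func (Bᴷ m) r
      ... | i′ , refl , eq = colour B (α~ m i i′ eq)

      pieceSim : ∀ {x p y x′ y′} → Piece x p y → x ≈ᴳ x′ → y ≈ᴳ y′ → Simulates* G G′ x p y x′ y′
      pieceSim (outerP {u} {q} {v} π refl refl refl) r s with ≈ᴳ-outer⁻ {u} r | ≈ᴳ-outer⁻ {v} s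
      ... | u′ , refl , r′ | v′ , refl , s′ with fin (sim B) r′ s′ π
      ... | q′ , π′ , e = map inj₁ q′ , L′.outer-path π′ ,
        ≈-trans (≈-reflexive (outer-word u q v))
        (≈-trans e (≈-reflexive (sym (L′.outer-word u′ q′ v′))))
      pieceSim (innerP {e} {u} {q} {v} π refl refl refl) r s with total B e
      ... | e′ , m with ≈ᴳ-inner⁻ {u = u} m r | ≈ᴳ-inner⁻ {u = v} m s
      ... | u′ , refl , r′ | v′ , refl , s′ with fin (sim (Bᴷ m)) r′ s′ π
      ... | q′ , π′ , w≈ = map (λ w → inj₂ (e′ , w)) q′ , L′.inner-path π′ ,
        ≈-trans (≈-reflexive (inner-word e u q v))
        (≈-trans (++-cong (ext-≈ m r′) (++-cong w≈ (ext-≈ m s′)))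
        (≈-reflexive (sym (L′.inner-word e′ u′ q′ v′))))

      piecesSim : ∀ {x p y x′ y′} → Pieces x p y → x ≈ᴳ x′ → y ≈ᴳ y′ → Simulates* G G′ x p y x′ y′
      piecesSim [ P ] r s = pieceSim P r s
      piecesSim {x} {_} {y} {x′} {y′} (_∣_∷_ {p = p} {v} {q} P (_ , t) Ps) r s with ≈ᴳ-concrete t
      ... | v′ , refl with pieceSim P r t | piecesSim Ps t s
      ... | p′ , π′ , e | q′ , τ′ , e′ = p′ ++ v′ ∷ q′ , snocWalk π′ τ′ ,
        ≈-trans (≈-reflexive (snoc-word {H = G} (col G x) (col G y) p v q))
        (≈-trans (overlap-≈ (col G x) (col G′ x′) (colours G p) (colours G′ p′)
            (γ G v ∷ []) (γ G′ v′ ∷ []) (colours G q ++ col G y) (colours G′ q′ ++ col G′ y′)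
            (≈ᴳ-colour t) e e′)
        (≈-reflexive (sym (snoc-word {H = G′} (col G′ x′) (col G′ y′) p′ v′ q′))))

      -- After its start such a path meets no attached node, as these are matched. It therefore
      -- stays in the component of its first edge, where the given bisimulation simulates it as a
      -- whole.
      uncut : ∀ {x x′ p} → x ≈ᴳ x′ → Walkω G x p → (∀ j → ¬ Cut (inj₁ (p j))) → Simulatesω G G′ x p x′
      uncut {x} {x′} {p} r (e₀ , es) ¬cut with edgeView e₀
      ... | outerE {u} {inj₁ w₀} h refl e with ≈ᴳ-outer⁻ {u} r
      ...   | u′ , refl , r′ = simulate
        (follow inj₁ (λ w w′ → _⟶_ H (inj₁ w) (inj₁ w′)) p next w₀ (inj₁-injective e))
        where
        next : ∀ i w → p i ≡ inj₁ w → ∃[ w′ ] p (suc i) ≡ inj₁ w′ × _⟶_ H (inj₁ w) (inj₁ w′)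
        next i w e with edgeView (es i)
        ... | outerE {inj₁ _} {inj₁ w′} h eu e′ with trans (sym e) (inj₁-injective eu)
        ...   | refl = w′ , inj₁-injective e′ , h
        next i w e | innerE {d} {inj₂ j} h eu e′ = ⊥-elim (¬cut i (subst Cut (sym eu) (cut-α d _)))
        next i w e | innerE {d} {inj₁ _} h eu e′ with trans (sym e) (inj₁-injective eu)
        ...   | ()

        simulate : (∃[ q ] q 0 ≡ w₀ × (∀ i → p i ≡ inj₁ (q i)) × (∀ i → _⟶_ H (inj₁ (q i)) (inj₁ (q (suc i))))) →
               Simulatesω G G′ (out u) p (out′ u′)
        simulate (q , refl , p≗ , hs) with inf (sim B) r′ (h , hs)
        ... | q′ , (h′ , hs′) , w≈ = inj₁ ∘ q′ ,
          (outer h′ , λ i → outer (hs′ i)) ,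
          ≈ω-trans (≗⇒≈ω (λ i → trans (++ω-cong (col G (out u)) (cong (γ G) ∘ p≗) i) (outer-wordω u q i)))
          (≈ω-trans w≈ (≈ω-sym (≗⇒≈ω (L′.outer-wordω u′ q′))))
      uncut {x} {x′} {p} r (e₀ , es) ¬cut | innerE {d} {u} {inj₂ i} h ex e =
        ⊥-elim (¬cut 0 (subst Cut (sym e) (cut-α d _)))
      uncut {x} {x′} {p} r (e₀ , es) ¬cut | innerE {d} {u} {inj₁ w₀} h refl e with total B d
      ... | d′ , m with ≈ᴳ-inner⁻ {u = u} m r
      ... | u′ , refl , r′ = simulate
        (follow (λ w → inj₂ (d , w)) (λ w w′ → _⟶_ (K d) (inj₁ w) (inj₁ w′)) p next w₀ (inj₁-injective e))
        where
        next : ∀ i w → p i ≡ inj₂ (d , w) → ∃[ w′ ] p (suc i) ≡ inj₂ (d , w′) × _⟶_ (K d) (inj₁ w) (inj₁ w′)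
        next i w e with edgeView (es i)
        ... | innerE {d′} {u} {inj₂ j} h eu e′ = ⊥-elim (¬cut (suc i) (subst Cut (sym e′) (cut-α d′ _)))
        ... | innerE {d′} {inj₂ j} {inj₁ _} h eu e′ = ⊥-elim (¬cut i (subst Cut (sym eu) (cut-α d′ _)))
        ... | innerE {d′} {inj₁ _} {inj₁ w′} h eu e′ with trans (sym e) (inj₁-injective eu)
        ...   | refl = w′ , inj₁-injective e′ , h
        next i w e | outerE {inj₁ _} h eu e′ with trans (sym e) (inj₁-injective eu)
        ...   | ()

        simulate : (∃[ q ] q 0 ≡ w₀ × (∀ i → p i ≡ inj₂ (d , q i)) × (∀ i → _⟶_ (K d) (inj₁ (q i)) (inj₁ (q (suc i))))) →
               Simulatesω G G′ (inn d u) p (inn′ d′ u′)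
        simulate (q , refl , p≗ , hs) with inf (sim (Bᴷ m)) r′ (h , hs)
        ... | q′ , (h′ , hs′) , w≈ = (λ i → inj₂ (d′ , q′ i)) ,
          (inner d′ h′ , λ i → inner d′ (hs′ i)) ,
          ≈ω-trans (≗⇒≈ω (λ i → trans (++ω-cong (col G (inn d u)) (cong (γ G) ∘ p≗) i) (inner-wordω d u q i)))
          (≈ω-trans (++ω-≈ (ext-≈ m r′) w≈) (≈ω-sym (≗⇒≈ω (L′.inner-wordω d′ u′ q′))))

    ≈ᴳ-sim : TraceSim G G′ _≈ᴳ_
    ≈ᴳ-sim = record
      { fin = λ r s π → piecesSim (pieces π) r s
      ; inf = OmegaSim.~-inf {H = G} {G′} _≈ᴳ_ ≈ᴳ-concrete ≈ᴳ-colour (λ r s π → piecesSim (pieces π) r s) uncut }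

  replace-Bisim : {H : Skeleton COL n} {H′ : Skeleton COL n′} (B : Bisim H H′)
    {k : E H → ℕ} {K : ∀ e → Skeleton COL (k e)} (k≡ : ∀ e → k e ≡ len H e)
    {k′ : E H′ → ℕ} {K′ : ∀ e → Skeleton COL (k′ e)} (k′≡ : ∀ e → k′ e ≡ len H′ e)
    (Bᴷ₀ : ∀ {e e′} → _~ᴱ_ B e e′ → Bisim (K e) (K′ e′)) →
    Bisim (replaceˢ H K k≡) (replaceˢ H′ K′ k′≡)
  replace-Bisim B k≡ k′≡ Bᴷ₀ = record
    { _~_ = X._≈ᴳ_ ; _~ᴱ_ = X._≈ᴱ_ ; n≡ = n≡ B
    ; ~-func = X.≈ᴳ-func ; ~-inj = λ r s → Y.≈ᴳ-func (flip⁻ r) (flip⁻ s)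
    ; ~ᴱ-func = X.≈ᴱ-func ; ~ᴱ-inj = Y.≈ᴱ-func
    ; total = X.≈ᴱ-total ; surj = Y.≈ᴱ-total
    ; len≡ = λ { (m , r) → len≡ (X.Bᴷ m) r }
    ; ~-abstr = λ i i′ e → X.outerⁱ (~-abstr B i i′ e)
    ; ~-α = λ { (m , r) i i′ e → X.≈ᴳ-inner m (~-α (X.Bᴷ m) r i i′ e) }
    ; colour = X.≈ᴳ-colour
    ; sim = X.≈ᴳ-sim
    ; sim⁻¹ = record
      { fin = λ r s → fin Y.≈ᴳ-sim (flip⁻ r) (flip⁻ s)
      ; inf = λ r → inf Y.≈ᴳ-sim (flip⁻ r) } }
    where
    module X = Replacement B k≡ k′≡ Bᴷ₀
    -- Reversal leaves the type of proofs that two hyperedges are related unchanged, so `canonical`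
    -- singles out the same proof in `X` and `Y`, and `flip⁻` needs no transport.
    module Y = Replacement (Bisim-sym B) k′≡ k≡ (Bisim-sym ∘ Bᴷ₀)

    flip⁻ : ∀ {x y} → x X.≈ᴳ y → y Y.≈ᴳ x
    flip⁻ (X.outerᵛ r)   = Y.outerᵛ r
    flip⁻ (X.outerⁱ r)   = Y.outerⁱ r
    flip⁻ (X.innerᵛ m r) = Y.innerᵛ m r

-- Unit and associativity laws of replacement

private variable
  a b : Level

module _ (em : ExcludedMiddle 0ℓ) {COL : Set} (M : Büchi COL) where
  open Bisimulation em M
  open Words em M using (canonical)
  open Bisim

  private variable
    k : ℕ

  replaceˢ-cong : (H : Skeleton COL n) {k : E H → ℕ} (K K′ : ∀ e → Skeleton COL (k e))
                  (k≡ : ∀ e → k e ≡ len H e) → (∀ {e e′} → e ≡ e′ → Bisim (K e) (K′ e′)) →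
                  Bisim (replaceˢ H K k≡) (replaceˢ H K′ k≡)
  replaceˢ-cong H {k} K K′ k≡ B = replace-Bisim {H = H} {H′ = H} (Bisim-refl {H = H})
    {k = k} {K = K} k≡ {k′ = k} {K′ = K′} k≡ B

  handleˢ : (k : ℕ) → Skeleton COL k
  handleˢ k = record { V = ⊥ ; E = ⊤ ; _⟶_ = λ _ _ → ⊥ ; len = λ _ → k ; α = λ _ → inj₂ ; γ = λ () }

  handle-Iso : ∀ {ACT : Set} {LAB : Set a} (A : LAB) k → Iso (skeleton (handle {ACT = ACT} {COL} A k)) (handleˢ k)
  handle-Iso A k = record
    { V↔ = ↔-refl ; E↔ = ↔-refl ; len≡ = λ _ → refl ; α≡ = λ _ _ _ eq → cong inj₂ (toℕ-injective eq)
    ; edges = λ () ; edges⁻ = λ () ; γ≗ = λ () }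

  module _ (X : Skeleton COL k) (k≡ : ∀ e → k ≡ len (handleˢ k) e) where

    private
      to : V (replaceˢ (handleˢ k) (λ _ → X) k≡) → V X
      to (inj₂ (_ , v)) = v

      inn : W X → W (replaceˢ (handleˢ k) (λ _ → X) k≡)
      inn = innˢ (handleˢ k) (λ _ → X) k≡ tt

      to-inn : ∀ w → Sum.map₁ to (inn w) ≡ w
      to-inn (inj₁ _) = refl
      to-inn (inj₂ i) = cong inj₂ (cast-is-id (k≡ tt) i)

      inn-from : ∀ w → inn w ≡ Sum.map₁ (λ v → inj₂ (tt , v)) w
      inn-from (inj₁ _) = refl
      inn-from (inj₂ i) = cong inj₂ (cast-is-id (k≡ tt) i)

      edge→ : ∀ {x y} → _⟶_ (replaceˢ (handleˢ k) (λ _ → X) k≡) x y → _⟶_ X (Sum.map₁ to x) (Sum.map₁ to y)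
      edge→ (inner _ {u} {v = v} h) = subst₂ (_⟶_ X) (sym (to-inn u)) (sym (to-inn v)) h

      edge← : ∀ {x y} → _⟶_ X x y →
              _⟶_ (replaceˢ (handleˢ k) (λ _ → X) k≡)
                  (Sum.map₁ (λ v → inj₂ (tt , v)) x) (Sum.map₁ (λ v → inj₂ (tt , v)) y)
      edge← {x} {y} h =
        subst₂ (_⟶_ (replaceˢ (handleˢ k) (λ _ → X) k≡)) (inn-from x) (inn-from y) (inner tt h)

    handleˢ-replace : Iso (replaceˢ (handleˢ k) (λ _ → X) k≡) X
    handleˢ-replace = record
      { V↔ = mk↔ₛ′ to (λ v → inj₂ (tt , v)) (λ _ → refl) (λ { (inj₂ _) → refl })
      ; E↔ = mk↔ₛ′ proj₂ (tt ,_) (λ _ → refl) (λ _ → refl)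
      ; len≡ = λ _ → refl
      ; α≡ = λ (_ , f) i i′ eq → trans (to-inn (α X f i)) (cong (α X f) (toℕ-injective eq))
      ; edges = λ {x} {y} → edge→ {x} {y} ; edges⁻ = λ {x} {y} → edge← {x} {y}
      ; γ≗ = λ { (inj₂ _) _ → refl } }

  -- Applied to the siblings of the subtree under consideration: being complete, they have no
  -- hyperedge and are unaffected by plugging.
  replace-none : (H : Skeleton COL n) → ¬ E H → {k : E H → ℕ} (K : ∀ e → Skeleton COL (k e))
                 (k≡ : ∀ e → k e ≡ len H e) → Iso (replaceˢ H K k≡) H
  replace-none H ¬e K k≡ = record
    { V↔ = mk↔ₛ′ to inj₁ (λ _ → refl) (λ { (inj₁ _) → refl ; (inj₂ (e , _)) → ⊥-elim (¬e e) })
    ; E↔ = mk↔ₛ′ proj₁ (⊥-elim ∘ ¬e) (⊥-elim ∘ ¬e) (⊥-elim ∘ ¬e ∘ proj₁)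
    ; len≡ = ⊥-elim ∘ ¬e ∘ proj₁
    ; α≡ = ⊥-elim ∘ ¬e ∘ proj₁
    ; edges = λ {x} {y} → edge→ {x} {y} ; edges⁻ = λ {x} {y} → edge← {x} {y}
    ; γ≗ = λ { (inj₁ _) _ → refl ; (inj₂ (e , _)) → ⊥-elim (¬e e) } }
    where
    to : V (replaceˢ H K k≡) → V H
    to (inj₁ v)       = v
    to (inj₂ (e , _)) = ⊥-elim (¬e e)

    to-out : ∀ u → Sum.map₁ to (outˢ H K k≡ u) ≡ u
    to-out (inj₁ _) = refl
    to-out (inj₂ _) = refl

    edge→ : ∀ {x y} → _⟶_ (replaceˢ H K k≡) x y → _⟶_ H (Sum.map₁ to x) (Sum.map₁ to y)
    edge→ (outer {u} {v = v} h) = subst₂ (_⟶_ H) (sym (to-out u)) (sym (to-out v)) h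
    edge→ (inner e _)           = ⊥-elim (¬e e)

    edge← : ∀ {x y} → _⟶_ H x y → _⟶_ (replaceˢ H K k≡) (Sum.map₁ inj₁ x) (Sum.map₁ inj₁ y)
    edge← h = outer h

  module _ (H : Skeleton COL n) {k : E H → ℕ} (K : ∀ e → Skeleton COL (k e)) (k≡ : ∀ e → k e ≡ len H e)
           {l : E (replaceˢ H K k≡) → ℕ} (L : ∀ x → Skeleton COL (l x))
           (l≡ : ∀ x → l x ≡ len (replaceˢ H K k≡) x) where

    private
      HK = replaceˢ H K k≡

      KL : ∀ e → Skeleton COL (k e)
      KL e = replaceˢ (K e) (λ f → L (e , f)) (λ f → l≡ (e , f))

      Left  = replaceˢ HK L l≡
      Right = replaceˢ H KL k≡

      to : V Left → V Right
      to (inj₁ (inj₁ v))       = inj₁ v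
      to (inj₁ (inj₂ (e , v))) = inj₂ (e , inj₁ v)
      to (inj₂ ((e , f) , v))  = inj₂ (e , inj₂ (f , v))

      from : V Right → V Left
      from (inj₁ v)                  = inj₁ (inj₁ v)
      from (inj₂ (e , inj₁ v))       = inj₁ (inj₂ (e , v))
      from (inj₂ (e , inj₂ (f , v))) = inj₂ ((e , f) , v)

      out₁ = outˢ H K k≡
      inn₁ = innˢ H K k≡
      out₂ = outˢ HK L l≡
      inn₂ = innˢ HK L l≡
      outᴿ = outˢ H KL k≡
      innᴿ = innˢ H KL k≡
      outᴷ : ∀ e → W (K e) → W (KL e)
      outᴷ e = outˢ (K e) (λ f → L (e , f)) (λ f → l≡ (e , f))
      innᴷ : ∀ e f → W (L (e , f)) → W (KL e)
      innᴷ e = innˢ (K e) (λ f → L (e , f)) (λ f → l≡ (e , f))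

      to-out-out : ∀ u → Sum.map₁ to (out₂ (out₁ u)) ≡ outᴿ u
      to-out-out (inj₁ _) = refl
      to-out-out (inj₂ _) = refl

      to-out-inn : ∀ e u → Sum.map₁ to (out₂ (inn₁ e u)) ≡ innᴿ e (outᴷ e u)
      to-out-inn e (inj₁ _) = refl
      to-out-inn e (inj₂ i) = to-out-out (α H e (cast (k≡ e) i))

      to-inn : ∀ e f u → Sum.map₁ to (inn₂ (e , f) u) ≡ innᴿ e (innᴷ e f u)
      to-inn e f (inj₁ _) = refl
      to-inn e f (inj₂ i) = to-out-inn e (α (K e) f (cast (l≡ (e , f)) i))

      from-to : ∀ x → from (to x) ≡ x
      from-to (inj₁ (inj₁ _)) = refl
      from-to (inj₁ (inj₂ _)) = refl
      from-to (inj₂ _)        = refl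

      to-from : ∀ x → to (from x) ≡ x
      to-from (inj₁ _)              = refl
      to-from (inj₂ (_ , inj₁ _))   = refl
      to-from (inj₂ (_ , inj₂ _))   = refl

      transpose : {x : W Left} {y : W Right} → Sum.map₁ to x ≡ y → x ≡ Sum.map₁ from y
      transpose {inj₁ v} refl = cong inj₁ (sym (from-to v))
      transpose {inj₂ _} refl = refl

      edge→ : ∀ {x y} → _⟶_ Left x y → _⟶_ Right (Sum.map₁ to x) (Sum.map₁ to y)
      edge→ (outer (outer {u} {v = v} h)) =
        subst₂ (_⟶_ Right) (sym (to-out-out u)) (sym (to-out-out v)) (outer h)
      edge→ (outer (inner e {u} {v = v} h)) =
        subst₂ (_⟶_ Right) (sym (to-out-inn e u)) (sym (to-out-inn e v)) (inner e (outer h))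
      edge→ (inner (e , f) {u} {v = v} h) =
        subst₂ (_⟶_ Right) (sym (to-inn e f u)) (sym (to-inn e f v)) (inner e (inner f h))

      edge← : ∀ {x y} → _⟶_ Right x y → _⟶_ Left (Sum.map₁ from x) (Sum.map₁ from y)
      edge← (outer {u} {v = v} h) =
        subst₂ (_⟶_ Left) (transpose (to-out-out u)) (transpose (to-out-out v)) (outer (outer h))
      edge← (inner e (outer {u} {v = v} h)) =
        subst₂ (_⟶_ Left) (transpose (to-out-inn e u)) (transpose (to-out-inn e v)) (outer (inner e h))
      edge← (inner e (inner f {u} {v = v} h)) =
        subst₂ (_⟶_ Left) (transpose (to-inn e f u)) (transpose (to-inn e f v)) (inner (e , f) h)

    -- Both sides consist of the same three layers, bracketed differently. The law shifts the border
    -- between a subtree and its context.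
    replace-assoc : Iso Left Right
    replace-assoc = record
      { V↔ = mk↔ₛ′ to from to-from from-to
      ; E↔ = mk↔ₛ′ (λ ((e , f) , g) → e , f , g) (λ (e , f , g) → (e , f) , g) (λ _ → refl) (λ _ → refl)
      ; len≡ = λ _ → refl
      ; α≡ = λ ((e , f) , g) i i′ eq → trans (to-inn e f (α (L (e , f)) g i))
          (cong (innᴿ e ∘ innᴷ e f ∘ α (L (e , f)) g) (toℕ-injective eq))
      ; edges = λ {x} {y} → edge→ {x} {y} ; edges⁻ = λ {x} {y} → edge← {x} {y}
      ; γ≗ = λ { (inj₁ (inj₁ _)) _ → refl ; (inj₁ (inj₂ _)) _ → refl ; (inj₂ _) _ → refl } }

  module _ {ACT : Set} {LAB : Set a} {LAB′ : Set b} where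

    skeleton-replace : (H : HG ACT COL LAB n) {k : HG.E H → ℕ} (K : ∀ e → HG ACT COL LAB′ (k e))
                       (k≡ : ∀ e → k e ≡ HG.len H e) →
                       Iso (skeleton (replace H K k≡)) (replaceˢ (skeleton H) (λ e → skeleton (K e)) k≡)
    skeleton-replace H K k≡ = record
      { V↔ = ↔-refl ; E↔ = ↔-refl ; len≡ = λ _ → refl
      ; α≡ = λ (e , f) i i′ eq → trans (map₁-id _) (trans (inn≡ e (HG.α (K e) f i))
               (cong (λ i → inn e (HG.α (K e) f i)) (toℕ-injective eq)))
      ; edges = λ {x} {y} h → subst₂ (_⟶_ S) (sym (map₁-id x)) (sym (map₁-id y)) (edge→ h)
      ; edges⁻ = λ {x} {y} h → subst₂ (HG._⟶_ R) (sym (map₁-id x)) (sym (map₁-id y)) (edge← h)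
      ; γ≗ = λ { (inj₁ _) _ → refl ; (inj₂ _) _ → refl } }
      where
      R = replace H K k≡
      S = replaceˢ (skeleton H) (λ e → skeleton (K e)) k≡
      inn = innˢ (skeleton H) (λ e → skeleton (K e)) k≡

      inn≡ : ∀ e u → innerNode H K k≡ e u ≡ inn e u
      inn≡ e (inj₁ _) = refl
      inn≡ e (inj₂ _) = refl

      edge→ : ∀ {x y} → HG._⟶_ R x y → _⟶_ S x y
      edge→ (a , outer h)               = outer (a , h)
      edge→ (a , inner e {u} {v = v} h) = subst₂ (_⟶_ S) (sym (inn≡ e u)) (sym (inn≡ e v)) (inner e (a , h))

      edge← : ∀ {x y} → _⟶_ S x y → HG._⟶_ R x y
      edge← (outer (a , h)) = a , outer h
      edge← (inner e {u} {v = v} (a , h)) = subst₂ (HG._⟶_ R) (inn≡ e u) (inn≡ e v) (a , inner e h)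

    skeleton-plug : (H : HG ACT COL LAB n) (h : OneHole H k) (X : HG ACT COL LAB′ k) →
                    Iso (skeleton (plug H h X)) (replaceˢ (skeleton H) (λ _ → skeleton X) (OneHole.k≡len h))
    skeleton-plug H h X = skeleton-replace H (λ _ → X) (OneHole.k≡len h)

  -- Derivation trees of the recoloured grammar

  module _ {ACT : Set} (G : HRG ACT COL) where
    open HRG G
    open Recolouring G M
    open Refined
    open Derivation Gᴹ

    stripped : ∀ {AX} → Tree AX → Skeleton COL (ar (proj₁ AX))
    stripped T = skeleton (delete𝓜 (assemble T))

    module _ {A : N} (r : P A) where

      Subs : Set₁
      Subs = (e : HG.E (rhs r)) → Skeleton COL (ar (HG.ℓ (rhs r) e))

      ⟪_⟫ : Subs → Skeleton COL (ar A)
      ⟪ s ⟫ = replaceˢ (skeleton (rhs r)) s (λ e → sym (rank r e))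

      ⟪⟫-cong : (s t : Subs) → (∀ e → Bisim (s e) (t e)) → Bisim ⟪ s ⟫ ⟪ t ⟫
      ⟪⟫-cong s t B = replaceˢ-cong (skeleton (rhs r)) s t (λ e → sym (rank r e)) λ { {e} refl → B e }

      skeleton-⟦⟧ : (s : Assignment r) → Iso (skeleton (r ⟦ s ⟧)) ⟪ (λ e → skeleton (s e)) ⟫
      skeleton-⟦⟧ s = skeleton-replace (rhs r) s (λ e → sym (rank r e))

      handleAtˢ : Subs → HG.E (rhs r) → Subs
      handleAtˢ s e e′ with HG._≟E_ (rhs r) e′ e
      ... | yes _ = handleˢ (ar (HG.ℓ (rhs r) e′))
      ... | no  _ = s e′

      skeleton-handleAt : (s : Subs) (t : Assignment r) → (∀ e → Bisim (s e) (skeleton (t e))) →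
                          ∀ e e′ → Bisim (handleAtˢ s e e′) (skeleton (handleAt r t e e′))
      skeleton-handleAt s t B e e′ with HG._≟E_ (rhs r) e′ e
      ... | yes _ = Bisim-sym (fromIso (handle-Iso (HG.ℓ (rhs r) e′) (ar (HG.ℓ (rhs r) e′))))
      ... | no  _ = B e′

      module _ (s : Subs) (¬s : ∀ e → ¬ E (s e)) (e : HG.E (rhs r)) where

        open Decidable⇒UIP (HG._≟E_ (rhs r)) using (≡-irrelevant)

        handleAtˢ-hole : E (handleAtˢ s e e)
        handleAtˢ-hole with HG._≟E_ (rhs r) e e
        ... | yes _   = tt
        ... | no  e≢e = ⊥-elim (e≢e refl)

        -- By `¬s` all hyperedges come from the handle at `e`, so their arity is that of the label
        -- of `e`.
        handleAtˢ-len : ∀ e′ f → ar (HG.ℓ (rhs r) e) ≡ len (handleAtˢ s e e′) f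
        handleAtˢ-len e′ f with HG._≟E_ (rhs r) e′ e
        ... | yes refl = refl
        ... | no  _    = ⊥-elim (¬s e′ f)

        private
          -- Besides bisimilarity, the proof must know that each node of the plugged copy of `s e`
          -- is matched with itself. `e′` stays general so that the decision `e′ ≟ e` can be
          -- abstracted, hence the `subst`.
          Refill : ∀ {e′} (X : Skeleton COL (ar (HG.ℓ (rhs r) e′))) → (∀ f → ar (HG.ℓ (rhs r) e) ≡ len X f) → Set₁
          Refill {e′} X k≡ = Σ[ B ∈ Bisim Y (s e′) ]
            ((e≡e′ : e ≡ e′) → ∀ f v → _~_ {H = Y} {H′ = s e′} B (inj₁ (inj₂ (f , v))) (inj₁ (subst (V ∘ s) e≡e′ v)))
            where
            Y : Skeleton COL (ar (HG.ℓ (rhs r) e′))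
            Y = replaceˢ X (λ _ → s e) k≡

          refill : ∀ e′ k≡ → Refill {e′} (handleAtˢ s e e′) k≡
          refill e′ k≡ with HG._≟E_ (rhs r) e′ e
          ... | yes refl = fromIso (handleˢ-replace (s e) k≡) ,
            -- Hyperedges have decidable equality, so any proof of `e ≡ e` is `refl` and the `subst`
            -- disappears.
            λ e≡e _ v → cong (λ e≡e → inj₁ (subst (V ∘ s) e≡e v)) (≡-irrelevant refl e≡e)
          ... | no e′≢e = fromIso (replace-none (s e′) (¬s e′) (λ _ → s e) k≡) ,
            λ e≡e′ → ⊥-elim (e′≢e (sym e≡e′))

        -- By associativity the plugging happens inside each component: the handle at `e` becomes
        -- `s e`, and the others have nothing to replace.
        handleAtˢ-plug : (k≡ : ∀ x → ar (HG.ℓ (rhs r) e) ≡ len ⟪ handleAtˢ s e ⟫ x) →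
          Σ[ B ∈ Bisim (replaceˢ ⟪ handleAtˢ s e ⟫ (λ _ → s e) k≡) ⟪ s ⟫ ]
          (∀ f v → _~_ B (inj₁ (inj₂ ((e , f) , v))) (inj₁ (inj₂ (e , v))))
        handleAtˢ-plug k≡ =
          Bisim-trans
            (fromIso (replace-assoc (skeleton (rhs r)) (handleAtˢ s e) (λ e → sym (rank r e)) (λ _ → s e) k≡))
            (replaceˢ-cong (skeleton (rhs r)) filled s (λ e → sym (rank r e)) family) ,
          λ f v → inj₁ (inj₂ (e , inj₂ (f , v))) , refl ,
            Replacement.innerᵛ refl
              -- The congruence takes the bisimulation at the proof `canonical refl`, while the
              -- matching is known at `refl`.
              (subst (λ m → _~_ (family m) (inj₁ (inj₂ (f , v))) (inj₁ v)) (≡-irrelevant refl (canonical refl))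
                (proj₂ (refill e (λ f → k≡ (e , f))) refl f v))
          where
          filled : Subs
          filled e′ = replaceˢ (handleAtˢ s e e′) (λ _ → s e) (λ f → k≡ (e′ , f))

          family : ∀ {e′ e″} → e′ ≡ e″ → Bisim (filled e′) (s e″)
          family {e′} refl = proj₁ (refill e′ (λ f → k≡ (e′ , f)))

    noHyperedge : ∀ {A} {T : Tree A} → Complete T → ¬ E (stripped T)
    noHyperedge (node cs) (e , f) = noHyperedge (cs e) f

    strip-node : ∀ {AX} (ρ : Pᴹ AX) T →
                 Iso (stripped (node ρ T)) (⟪_⟫ (P≡.r (Pᴹ.rule ρ)) (λ e → stripped (T e)))
    strip-node ρ T = record
      { V↔ = ↔-refl ; E↔ = ↔-refl ; len≡ = λ _ → refl
      ; α≡ = λ (e , f) i i′ eq → trans (map₁-id _) (trans (inn≡ e (HG.α (assemble (T e)) f i))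
               (cong (λ i → inn e (HG.α (assemble (T e)) f i)) (toℕ-injective eq)))
      ; edges = λ {x} {y} h → subst₂ (_⟶_ S) (sym (map₁-id x)) (sym (map₁-id y)) (edge→ h)
      ; edges⁻ = λ {x} {y} h → subst₂ (HG._⟶_ R) (sym (map₁-id x)) (sym (map₁-id y)) (edge← h)
      ; γ≗ = λ { (inj₁ _) _ → refl ; (inj₂ _) _ → refl } }
      where
      R = assemble (node ρ T)
      S = ⟪_⟫ (P≡.r (Pᴹ.rule ρ)) (λ e → stripped (T e))
      innᴿ = innerNode (Pᴹ.rhsᴹ ρ) (λ e → assemble (T e)) (λ e → sym (rank (P≡.r (Pᴹ.rule ρ)) e))
      inn = innˢ (skeleton (rhs (P≡.r (Pᴹ.rule ρ)))) (λ e → stripped (T e))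
              (λ e → sym (rank (P≡.r (Pᴹ.rule ρ)) e))

      inn≡ : ∀ e u → innᴿ e u ≡ inn e u
      inn≡ e (inj₁ _) = refl
      inn≡ e (inj₂ _) = refl

      edge→ : ∀ {x y} → HG._⟶_ R x y → _⟶_ S x y
      edge→ (a , outer h)               = outer (a , h)
      edge→ (a , inner e {u} {v = v} h) = subst₂ (_⟶_ S) (sym (inn≡ e u)) (sym (inn≡ e v)) (inner e (a , h))

      edge← : ∀ {x y} → _⟶_ S x y → HG._⟶_ R x y
      edge← (outer (a , h)) = a , outer h
      edge← (inner e {u} {v = v} (a , h)) = subst₂ (HG._⟶_ R) (inn≡ e u) (inn≡ e v) (a , inner e h)

    ≅⇒Iso : {H H′ : HG ACT COLᴹ N≡ n} → H ≅ H′ → Iso (skeleton (delete𝓜 H)) (skeleton (delete𝓜 H′))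
    ≅⇒Iso {H = H} {H′} I = record
      { V↔ = V↔ ; E↔ = E↔ ; len≡ = len≡₀
      ; α≡ = λ e i i′ eq → trans (sym (onW≡ (HG.α H e i))) (trans (α≡ e i)
               (cong (HG.α H′ (onE e)) (toℕ-injective (trans (toℕ-cast (len≡₀ e) i) eq))))
      ; edges = λ {x} {y} (a , h) → a , subst₂ (λ x y → HG._⟶⟨_⟩_ H′ x a y) (onW≡ x) (onW≡ y)
                                            (Equivalence.to (edges x a y) h)
      ; edges⁻ = λ {x} {y} (a , h) → a , Equivalence.from (edges _ a _)
                       (subst₂ (λ x y → HG._⟶⟨_⟩_ H′ x a y) (sym (onW-from x)) (sym (onW-from y)) h)
      ; γ≗ = λ v c → γ≗ v (inj₁ c) }
      where
      open _≅_ I renaming (n≡ to n≡₀; len≡ to len≡₀)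

      onW≡ : ∀ w → onW w ≡ Sum.map₁ onV w
      onW≡ (inj₁ _) = refl
      onW≡ (inj₂ i) = cong inj₂ (cast-is-id n≡₀ i)

      onW-from : ∀ w → onW (Sum.map₁ (Inverse.from V↔) w) ≡ w
      onW-from (inj₁ v) = cong inj₁ (Inverse.strictlyInverseˡ V↔ v)
      onW-from (inj₂ i) = cong inj₂ (cast-is-id n≡₀ i)

    -- Congruence lifts the hypotheses for the subtrees to the right side of the root rule, and `𝔰≡`
    -- identifies the result with `𝔰`.
    sound : ∀ {AX} {T : Tree AX} → Complete T → Bisim (stripped T) (skeleton (𝔰 (proj₂ AX)))
    sound (node {r = ρ} {T} cs) = Bisim-trans (fromIso (strip-node ρ T))
      (Bisim-trans (⟪⟫-cong r (λ e → stripped (T e)) (λ e → skeleton (P≡.𝔱 (Pᴹ.rule ρ) e)) (λ e → sound (cs e)))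
      (Bisim-trans (Bisim-sym (fromIso (skeleton-⟦⟧ r (P≡.𝔱 (Pᴹ.rule ρ)))))
      (Bisim-sym (fromEquivalent (P≡.𝔰≡ (Pᴹ.rule ρ))))))
      where
      r = P≡.r (Pᴹ.rule ρ)

    module _ {A : N} {X : Refined A} where

      -- In the paper's notation, body is R[𝔱] and hollow is R[𝔱⟨e/B(e)°⟩].
      body : P≡ (A , X) → HG ACT COL N (ar A)
      body ρ = P≡.r ρ ⟦ P≡.𝔱 ρ ⟧

      hollow : (ρ : P≡ (A , X)) → HG.E (rhs (P≡.r ρ)) → HG ACT COL N (ar A)
      hollow ρ e = P≡.r ρ ⟦ handleAt (P≡.r ρ) (P≡.𝔱 ρ) e ⟧

      inContext : HG ACT COL N (ar A) → Skeleton COL (size X)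
      inContext Y = replaceˢ (skeleton (𝔠 X)) (λ _ → skeleton Y) (OneHole.k≡len (𝔠-hole X))

      whole≈ : (ρ : P≡ (A , X)) → Bisim (inContext (body ρ)) (skeleton (P≡.whole ρ))
      whole≈ ρ = Bisim-sym (fromIso (skeleton-plug (𝔠 X) (𝔠-hole X) (P≡.r ρ ⟦ P≡.𝔱 ρ ⟧)))

      𝔡≈ : (ρ : P≡ (A , X)) → ∀ e → Bisim (inContext (hollow ρ e)) (skeleton (𝔠 (P≡.l ρ e)))
      𝔡≈ ρ e = let B = fromEquivalent (P≡.𝔡≡ ρ e) in
        Bisim-trans (Bisim-sym (fromIso (skeleton-plug (𝔠 X) (𝔠-hole X) (hollow ρ e)))) (Bisim-sym B)

      body≈ : (ρ : Pᴹ (A , X)) → ∀ {T} → (∀ e → Complete (T e)) →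
              Bisim (stripped (node ρ T)) (skeleton (body (Pᴹ.rule ρ)))
      body≈ ρ {T} cs = Bisim-trans (fromIso (strip-node ρ T))
        (Bisim-trans (⟪⟫-cong r (λ e → stripped (T e)) (λ e → skeleton (P≡.𝔱 (Pᴹ.rule ρ) e)) (λ e → sound (cs e)))
        (Bisim-sym (fromIso (skeleton-⟦⟧ r (P≡.𝔱 (Pᴹ.rule ρ))))))
        where
        r = P≡.r (Pᴹ.rule ρ)

      hollow≈ : (ρ : Pᴹ (A , X)) (K : Subs (P≡.r (Pᴹ.rule ρ))) →
                (∀ e → Bisim (K e) (skeleton (P≡.𝔱 (Pᴹ.rule ρ) e))) →
                ∀ e → Bisim (⟪_⟫ (P≡.r (Pᴹ.rule ρ)) (handleAtˢ (P≡.r (Pᴹ.rule ρ)) K e)) (skeleton (hollow (Pᴹ.rule ρ) e))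
      hollow≈ ρ K B e = Bisim-trans
        (⟪⟫-cong r (handleAtˢ r K e) (λ e′ → skeleton (handleAt r (P≡.𝔱 (Pᴹ.rule ρ)) e e′))
          (skeleton-handleAt r K (P≡.𝔱 (Pᴹ.rule ρ)) B e))
        (Bisim-sym (fromIso (skeleton-⟦⟧ r (handleAt r (P≡.𝔱 (Pᴹ.rule ρ)) e))))
        where
        r = P≡.r (Pᴹ.rule ρ)

      inContext-cong : {D : Skeleton COL n} (B : Bisim D (skeleton (𝔠 X))) (k≡ : ∀ d → ar A ≡ len D d)
                       (S : Skeleton COL (ar A)) (Y : HG ACT COL N (ar A)) → Bisim S (skeleton Y) →
                       Bisim (replaceˢ D (λ _ → S) k≡) (inContext Y)
      inContext-cong {D = D} B k≡ S Y C = replace-Bisim {H = D} {H′ = skeleton (𝔠 X)} B {K = λ _ → S} k≡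
        {K′ = λ _ → skeleton Y} (OneHole.k≡len (𝔠-hole X)) (λ _ → C)

    -- D stands for the context of T, with T plugged into all its hyperedges.
    mark-correct : ∀ {AX} {T : Tree AX} → Complete T →
      (D : Skeleton COL n) (k≡ : ∀ d → ar≡ AX ≡ len D d) → Bisim D (skeleton (𝔠 (proj₂ AX))) →
      ∀ d v → (HG.γ (assemble T) v 𝓜 ≡ true) ⇔
              Models (replaceˢ D (λ _ → stripped T) k≡) (inj₁ (inj₂ (d , v)))
    mark-correct {AX = _ , X} (node {r = ρ} {T} cs) D k≡ B d (inj₁ w) =
      ⇔-sym (Models-transfer D≈whole marked) ⇔-∘
      (⊨⇔Models (P≡.whole (Pᴹ.rule ρ)) (inj₁ (P≡.inWhole (Pᴹ.rule ρ) w)) ⇔-∘ Pᴹ.mark-⊨ ρ w)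
      where
      D≈whole : Bisim (replaceˢ D (λ _ → stripped (node ρ T)) k≡) (skeleton (P≡.whole (Pᴹ.rule ρ)))
      D≈whole = Bisim-trans
        (inContext-cong {X = X} {D = D} B k≡ (stripped (node ρ T)) (body (Pᴹ.rule ρ)) (body≈ ρ cs))
        (whole≈ (Pᴹ.rule ρ))

      -- `𝔠 X` has a single hyperedge, so every `d` has it as partner.
      d~hole : _~ᴱ_ B d (OneHole.hole (𝔠-hole X))
      d~hole = let (d′ , m) = total B d in subst (_~ᴱ_ B d) (OneHole.unique (𝔠-hole X) d′) m

      marked : _~_ D≈whole (inj₁ (inj₂ (d , inj₁ w))) (inj₁ (P≡.inWhole (Pᴹ.rule ρ) w))
      -- The witnesses are the copies of `w` in the intermediate skeletons through which `D≈whole`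
      -- is composed.
      marked = inj₁ (inj₂ (OneHole.hole (𝔠-hole X) , inj₁ w)) ,
        Replacement.innerᵛ d~hole (inj₁ (inj₁ w) , refl , inj₁ (inj₁ w) , Replacement.outerᵛ refl , refl) , refl
    mark-correct {AX = _ , X} (node {r = ρ} {T} cs) D k≡ B d (inj₂ (e , w)) =
      Models-transfer D′≈D tracked ⇔-∘ mark-correct (cs e) D′ k≡′ B′ (d , e , hole) w
      where
      r = P≡.r (Pᴹ.rule ρ)

      K : Subs r
      K e = stripped (T e)

      ¬K : ∀ e → ¬ E (K e)
      ¬K e = noHyperedge (cs e)

      hole : E (handleAtˢ r K e e)
      hole = handleAtˢ-hole r K ¬K e

      -- The siblings in the new surroundings are the actual subtrees; `B′` exchanges them for the
      -- representatives `𝔱` by `sound`.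
      D′ : Skeleton COL _
      D′ = replaceˢ D (λ _ → ⟪_⟫ r (handleAtˢ r K e)) k≡

      k≡′ : ∀ x → ar (HG.ℓ (rhs r) e) ≡ len D′ x
      k≡′ (_ , e′ , f) = handleAtˢ-len r K ¬K e e′ f

      B′ : Bisim D′ (skeleton (𝔠 (P≡.l (Pᴹ.rule ρ) e)))
      B′ = Bisim-trans
        (inContext-cong {X = X} {D = D} B k≡ (⟪_⟫ r (handleAtˢ r K e)) (hollow (Pᴹ.rule ρ) e)
          (hollow≈ ρ K (λ e → sound (cs e)) e))
        (𝔡≈ (Pᴹ.rule ρ) e)

      plugged : (d : E D) →
        Σ[ C ∈ Bisim (replaceˢ (⟪_⟫ r (handleAtˢ r K e)) (λ _ → K e) (λ x → k≡′ (d , x))) (⟪_⟫ r K) ]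
        (∀ f v → _~_ C (inj₁ (inj₂ ((e , f) , v))) (inj₁ (inj₂ (e , v))))
      plugged d = handleAtˢ-plug r K ¬K e (λ x → k≡′ (d , x))

      D′≈D : Bisim (replaceˢ D′ (λ _ → K e) k≡′) (replaceˢ D (λ _ → stripped (node ρ T)) k≡)
      D′≈D = Bisim-trans
        (fromIso (replace-assoc D (λ _ → ⟪_⟫ r (handleAtˢ r K e)) k≡ (λ _ → K e) k≡′))
        (replaceˢ-cong D (λ d → replaceˢ (⟪_⟫ r (handleAtˢ r K e)) (λ _ → K e) (λ x → k≡′ (d , x)))
          (λ _ → stripped (node ρ T)) k≡ λ {d} _ →
          Bisim-trans (proj₁ (plugged d)) (Bisim-sym (fromIso (strip-node ρ T))))

      tracked : _~_ D′≈D (inj₁ (inj₂ ((d , e , hole) , w))) (inj₁ (inj₂ (d , inj₂ (e , w))))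
      tracked = inj₁ (inj₂ (d , inj₂ ((e , hole) , w))) , refl ,
        Replacement.innerᵛ refl (inj₁ (inj₂ (e , w)) , proj₂ (plugged d) hole w , refl)

    -- The induction starts with a bare handle as surroundings: `Z≡` makes `𝔠` equivalent to it, and
    -- plugging into it returns the tree's own hypergraph.
    recoloured-correct : (H : HG ACT COLᴹ N≡ n) → H ∈ 𝓛 → ∀ v →
                         (HG.γ H v 𝓜 ≡ true) ⇔ (_⊨_ (delete𝓜 H) (inj₁ v) M)
    recoloured-correct H ((A , X) , (_ , 𝔠≡) , T , c , I@(record { n≡ = refl })) v =
      -- To be read from the last line upwards: from `H` to the assembled tree, into the handle and
      -- out again, then back to `H`.
      ⇔-sym (⊨⇔Models (delete𝓜 H) (inj₁ v)) ⇔-∘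
      (⇔-sym (Models-transfer (fromIso (≅⇒Iso I)) refl) ⇔-∘
      (Models-transfer (fromIso (handleˢ-replace (stripped T) (λ _ → refl))) refl ⇔-∘
      (mark-correct c (handleˢ (ar A)) (λ _ → refl) handle≈𝔠 tt (_≅_.onV I v) ⇔-∘
      mk⇔ (trans (sym (_≅_.γ≗ I v 𝓜))) (trans (_≅_.γ≗ I v 𝓜)))))
      where
      handle≈𝔠 : Bisim (handleˢ (ar A)) (skeleton (𝔠 X))
      handle≈𝔠 = Bisim-trans (Bisim-sym (fromIso (handle-Iso A (ar A)))) (Bisim-sym (fromEquivalent 𝔠≡))

theorem3 : ExcludedMiddle (lsuc 0ℓ) →
    {ACT COL : Set} (G : HRG ACT COL) (M : Büchi COL) →
    let open Recolouring G M in
    ({n : ℕ} (H : HG ACT COL (HRG.N G) n) →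
    H ∈ Derivation.𝓛 (HRG.grammar G) → IsLTS H) →
    {n : ℕ} (H : HG ACT COLᴹ N≡ n) → H ∈ Derivation.𝓛 Gᴹ →
    (v : HG.V H) →
    (HG.γ H v 𝓜 ≡ true) ⇔ (_⊨_ (delete𝓜 H) (inj₁ v) M)
theorem3 em G M _ = recoloured-correct (lower-em em) M G
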